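{- Let $k>\ell\geq 1$ be integers. Then $$C(C_{2k+1},C_{2\ell+1})\leq\begin{cases}\frac{2(k+1)}{2\ell+1} & \text{if } k\leq 2\ell-1,\\[2pt] \frac{2k(2k-2\ell+1)-1}{2\ell(2k-2\ell+1)-1} & \text{if } k\geq 2\ell.\end{cases}$$
   Context: All graphs are finite and simple. $C_m$ denotes the cycle on $m$ vertices. $\operatorname{hom}(H,T)$ is the number of maps $V(H)\to V(T)$ sending every edge of $H$ to an edge of $T$, $t(H,T)=\operatorname{hom}(H,T)/v(T)^{v(H)}$, and $C(G,H)=\min\{c\in\mathbb{R}: t(G,T)\geq t(H,T)^c \text{ for all graphs } T\}$. -}

module Defs where

open import Data.Nat using (ℕ; zero; suc; _+_; _*_; _∸_; _^_; _≤_; _≡ᵇ_)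
open import Data.Bool using (Bool; true; false; if_then_else_; _∨_; _∧_; not)
open import Data.Fin using (Fin; toℕ)
import Data.Fin as F
open import Data.List.Base using (List; []; _∷_; map; concatMap; allFin)
open import Data.Bool.ListAction using (and)
open import Data.Nat.ListAction using (sum)
open import Relation.Binary.PropositionalEquality using (_≡_)

record RawGraph : Set where
  field
    V   : ℕ
    adj : Fin V → Fin V → Bool
open RawGraph public

record IsSimple (G : RawGraph) : Set where
  field
    symm   : ∀ i j → adj G i j ≡ adj G j i
    noLoop : ∀ i → adj G i i ≡ false

succMod : ℕ → ℕ → ℕ
succMod m i = if suc i ≡ᵇ m then 0 else suc i

Cycle : ℕ → RawGraph
Cycle m = record
  { V = m
  ; adj = λ i j → (toℕ j ≡ᵇ succMod m (toℕ i)) ∨ (toℕ i ≡ᵇ succMod m (toℕ j)) }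

allMaps : (m n : ℕ) → List (Fin m → Fin n)
allMaps zero    n = (λ ()) ∷ []
allMaps (suc m) n =
  concatMap (λ f → map (λ x → λ { F.zero → x ; (F.suc i) → f i }) (allFin n)) (allMaps m n)

isHom : (H T : RawGraph) → (Fin (V H) → Fin (V T)) → Bool
isHom H T f =
  and (map (λ i → and (map (λ j → not (adj H i j) ∨ adj T (f i) (f j)) (allFin (V H)))) (allFin (V H)))

hom : RawGraph → RawGraph → ℕ
hom H T = sum (map (λ f → if isHom H T f then 1 else 0) (allMaps (V H) (V T)))

-- "C(G,H) ≤ p/q", i.e. t(G,T) ≥ t(H,T)^(p/q) for every (nonempty) simple graph T,
-- where t(G,T) = hom(G,T)/v(T)^v(G). Raising to the q-th power and clearing
-- denominators gives the equivalent inequality over ℕ below (q ≥ 1).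
CLe : RawGraph → RawGraph → ℕ → ℕ → Set
CLe G H p q = (T : RawGraph) → IsSimple T → 1 ≤ V T →
  hom H T ^ p * V T ^ (V G * q) ≤ hom G T ^ q * V T ^ (V H * p)

{-# OPTIONS --safe #-}
module Submission where

-- Let A be the adjacency matrix of T, n = v(T), m = k - ℓ, E = tr A^(2ℓ+1),
-- a = tr A^(2k+1) and q = A^(2ℓ), so that E is the sum of q over the edges of T.
-- Choose a threshold S such that at least half of the closed (2ℓ+1)-walks use
-- only edges with q ≥ S and at least half use an edge with q ≤ S.
--
-- Let D be q restricted to the edges with q ≤ S.  It has total mass at least
-- c E and D ≤ S A, so the Sidorenko inequality for the even cycle of length
-- r = 2m + 2 gives  c E^r ≤ n^r tr D^r ≤ n^r S^(r-1) a.
--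
-- Let M be the adjacency matrix of the edges with q ≥ S.  Then tr M^(2ℓ+1) ≥ c E,
-- S tr M^r ≤ a and S tr M^2 ≤ E.  A lower bound for tr M^r follows from the
-- monotonicity of Schatten norms if r ≤ 2ℓ, and from the log-convexity of
-- p ↦ Σ|λ|^p at 2, 2ℓ+1, r if r > 2ℓ+1.
--
-- Eliminating S gives the theorem up to a constant depending only on k and ℓ,
-- which disappears on applying the bound to the tensor powers of T.

open import Defs
open import Data.Bool using (Bool; true; false; if_then_else_; _∨_; _∧_; not; T)
open import Data.Bool.ListAction using (and)
open import Data.Bool.Properties using (∨-zeroʳ)
open import Data.Fin using (Fin; toℕ; fromℕ; inject₁) renaming (zero to fzero; suc to fsuc)
open import Data.Fin.Properties using (toℕ-inject₁; toℕ-fromℕ; toℕ-injective; toℕ<n)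
open import Data.List.Base using (List; []; _∷_; _++_; map; length; concatMap; cartesianProduct; allFin)
open import Data.List.Membership.Propositional using (_∈_)
open import Data.List.Membership.Propositional.Properties using (∈-allFin)
open import Data.List.Properties using (map-++; map-∘; length-tabulate)
open import Data.List.Relation.Unary.Any using (here; there)
open import Data.Nat using (ℕ; zero; suc; _+_; _*_; _∸_; _^_; _≤_; _<_; _≤?_; _≡ᵇ_; z≤n; s≤s; >-nonZero)
open import Data.Nat.ListAction using (sum)
open import Data.Nat.ListAction.Properties using (sum-++)
open import Data.Nat.Properties
open import Data.Nat.Tactic.RingSolver using (solve-∀)
open import Data.Product using (∃; _×_; _,_; proj₁; proj₂; uncurry)
open import Data.Sum using (_⊎_; inj₁; inj₂)
open import Data.Unit using (⊤; tt)
open import Function using (_∘_; id)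
open import Relation.Nullary using (yes; no; contradiction)
open import Relation.Binary.PropositionalEquality using (_≡_; refl; sym; trans; cong; cong₂; subst; subst₂; module ≡-Reasoning)

-- Powers and log-convex sequences of natural numbers

^-distribʳ-* : ∀ x y n → (x * y) ^ n ≡ x ^ n * y ^ n
^-distribʳ-* x y zero    = refl
^-distribʳ-* x y (suc n) rewrite ^-distribʳ-* x y n =
  [m*n]*[o*p]≡[m*o]*[n*p] x y (x ^ n) (y ^ n)

^-swap : ∀ x m n → (x ^ m) ^ n ≡ (x ^ n) ^ m
^-swap x m n = trans (^-*-assoc x m n) (trans (cong (x ^_) (*-comm m n)) (sym (^-*-assoc x n m)))

^-cancelˡ-≤ : ∀ n {x y} → x ^ suc n ≤ y ^ suc n → x ≤ y
^-cancelˡ-≤ n xⁿ≤yⁿ = ≮⇒≥ λ y<x → <⇒≱ (^-monoˡ-< (suc n) y<x) xⁿ≤yⁿ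

x≤x^[1+n] : ∀ x n → x ≤ x ^ suc n
x≤x^[1+n] zero    n = z≤n
x≤x^[1+n] x@(suc _) n = m≤m*n x (x ^ n) {{m^n≢0 x n}}

4xy≤[x+y]² : ∀ x y → 4 * (x * y) ≤ (x + y) * (x + y)
4xy≤[x+y]² x y with ≤-total x y
... | inj₁ x≤y with d , refl ← m≤n⇒∃[o]m+o≡n x≤y = begin
  4 * (x * (x + d))         ≤⟨ m≤m+n _ (d * d) ⟩
  4 * (x * (x + d)) + d * d ≡⟨ solve x d ⟩
  (x + (x + d)) * (x + (x + d))         ∎
  where
  open ≤-Reasoning
  solve : ∀ x d → 4 * (x * (x + d)) + d * d ≡ (x + (x + d)) * (x + (x + d))
  solve = solve-∀
... | inj₂ y≤x with d , refl ← m≤n⇒∃[o]m+o≡n y≤x = begin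
  4 * ((y + d) * y)         ≤⟨ m≤m+n _ (d * d) ⟩
  4 * ((y + d) * y) + d * d ≡⟨ solve y d ⟩
  (y + d + y) * (y + d + y)         ∎
  where
  open ≤-Reasoning
  solve : ∀ y d → 4 * ((y + d) * y) + d * d ≡ (y + d + y) * (y + d + y)
  solve = solve-∀

-- Bernoulli's inequality (1 + 1/r)^n ≥ 1 + n/r multiplied by r^(n+1), which keeps it division-free
-- and true at r = 0.
bernoulli : ∀ r n → (r + n) * r ^ n ≤ suc r ^ n * r
bernoulli r zero = ≤-reflexive (solve r)
  where
  solve : ∀ r → (r + 0) * 1 ≡ 1 * r
  solve = solve-∀
bernoulli r (suc n) = begin
  (r + suc n) * (r * r ^ n)     ≤⟨ m≤m+n _ (n * r ^ n) ⟩
  (r + suc n) * (r * r ^ n) + n * r ^ n ≡⟨ solve r n (r ^ n) ⟩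
  suc r * ((r + n) * r ^ n)     ≤⟨ *-monoʳ-≤ (suc r) (bernoulli r n) ⟩
  suc r * (suc r ^ n * r)       ≡⟨ *-assoc (suc r) (suc r ^ n) r ⟨
  suc r ^ suc n * r             ∎
  where
  open ≤-Reasoning
  solve : ∀ r n p → (r + suc n) * (r * p) + n * p ≡ suc r * ((r + n) * p)
  solve = solve-∀

-- The limit step of the tensor power trick: if x ≥ y + 1, then x^n outgrows every constant multiple
-- of y^n. One explicit exponent suffices for the contradiction.
powers-bounded⇒≤ : ∀ C {x y} → (∀ n → x ^ n ≤ C * y ^ n) → x ≤ y
powers-bounded⇒≤ C {x} {zero} bound = begin
  x          ≡⟨ *-identityʳ x ⟨
  x ^ 1      ≤⟨ bound 1 ⟩
  C * 0      ≡⟨ *-zeroʳ C ⟩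
  0          ∎
  where open ≤-Reasoning
powers-bounded⇒≤ C {x} {y@(suc _)} bound = ≮⇒≥ λ y<x →
  <⇒≱ (m<n+m (C * y) (s≤s z≤n))
      (*-cancelʳ-≤ (y + C * y) (C * y) (y ^ N) {{m^n≢0 y N}} (begin
        (y + C * y) * y ^ N ≤⟨ bernoulli y N ⟩
        suc y ^ N * y       ≤⟨ *-monoˡ-≤ y (^-monoˡ-≤ N y<x) ⟩
        x ^ N * y           ≤⟨ *-monoˡ-≤ y (bound N) ⟩
        C * y ^ N * y       ≡⟨ solve C (y ^ N) y ⟩
        C * y * y ^ N       ∎))
  where
  open ≤-Reasoning
  N : ℕ
  -- With this exponent the Bernoulli factor y + N exceeds C * y, since y > 0.
  N = C * y
  solve : ∀ c p y → c * p * y ≡ c * y * p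
  solve = solve-∀

LogConvex : (ℕ → ℕ) → Set
LogConvex f = ∀ i → f (suc i) * f (suc i) ≤ f i * f (suc (suc i))

-- Raise f(j+1)² ≤ f(j) f(j+2) to the power j + 1, insert the induction hypothesis for f(j)^(j+1)
-- and cancel f(j+1)^j. The cancellation is why a vanishing f(j+1) is treated apart.
logConvex-step : ∀ f → LogConvex f → ∀ j → f j ^ suc j ≤ f 0 * f (suc j) ^ j
logConvex-step f lc zero = ≤-refl
logConvex-step f lc (suc j) with f (suc j) in eq
... | zero    = z≤n
... | y@(suc _) = *-cancelʳ-≤ _ _ (y ^ j) {{m^n≢0 y j}} (begin
  y * (y * y ^ j) * y ^ j         ≡⟨ regroup y (y ^ j) ⟩
  y ^ suc j * y ^ suc j           ≡⟨ ^-distribʳ-* y y (suc j) ⟨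
  (y * y) ^ suc j                 ≤⟨ ^-monoˡ-≤ (suc j) y²≤ ⟩
  (f j * z) ^ suc j               ≡⟨ ^-distribʳ-* (f j) z (suc j) ⟩
  f j ^ suc j * z ^ suc j         ≤⟨ *-monoˡ-≤ (z ^ suc j) ih ⟩
  f 0 * y ^ j * z ^ suc j         ≡⟨ solve (f 0) (y ^ j) (z ^ suc j) ⟩
  f 0 * z ^ suc j * y ^ j         ∎)
  where
  open ≤-Reasoning
  z : ℕ
  z = f (suc (suc j))
  y²≤ : y * y ≤ f j * z
  y²≤ = subst (λ u → u * u ≤ f j * z) eq (lc j)
  ih : f j ^ suc j ≤ f 0 * y ^ j
  ih = subst (λ u → f j ^ suc j ≤ f 0 * u ^ j) eq (logConvex-step f lc j)
  regroup : ∀ y p → y * (y * p) * p ≡ y * p * (y * p)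
  regroup = solve-∀
  solve : ∀ a b c → a * b * c ≡ a * c * b
  solve = solve-∀

-- In logarithms: the point at `j` lies below the chord from 0 to `j + d`, with denominators
-- cleared. The induction moves the right end of the chord from `i = j + d` to `suc i` by
-- `logConvex-step`, and then takes an `i`-th root.
logConvex-interpolate : ∀ f → LogConvex f → ∀ j d →
  f j ^ (j + d) ≤ f 0 ^ d * f (j + d) ^ j
logConvex-interpolate f lc j zero rewrite +-identityʳ j = ≤-reflexive (sym (*-identityˡ _))
logConvex-interpolate f lc zero (suc d) = ≤-reflexive (sym (*-identityʳ _))
logConvex-interpolate f lc j@(suc j′) (suc d) rewrite +-suc j′ d = ^-cancelˡ-≤ (j′ + d) (begin
  (f j ^ suc i) ^ i                          ≡⟨ ^-swap (f j) (suc i) i ⟩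
  (f j ^ i) ^ suc i                          ≤⟨ ^-monoˡ-≤ (suc i) (logConvex-interpolate f lc j d) ⟩
  (f 0 ^ d * f i ^ j) ^ suc i                ≡⟨ ^-distribʳ-* (f 0 ^ d) (f i ^ j) (suc i) ⟩
  (f 0 ^ d) ^ suc i * (f i ^ j) ^ suc i      ≡⟨ cong ((f 0 ^ d) ^ suc i *_) (^-swap (f i) j (suc i)) ⟩
  (f 0 ^ d) ^ suc i * (f i ^ suc i) ^ j      ≤⟨ *-monoʳ-≤ ((f 0 ^ d) ^ suc i) (^-monoˡ-≤ j (logConvex-step f lc i)) ⟩
  (f 0 ^ d) ^ suc i * (f 0 * f (suc i) ^ i) ^ j
    ≡⟨ cong₂ _*_ (^-*-assoc (f 0) d (suc i)) (^-distribʳ-* (f 0) (f (suc i) ^ i) j) ⟩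
  f 0 ^ (d * suc i) * (f 0 ^ j * (f (suc i) ^ i) ^ j)
    ≡⟨ *-assoc (f 0 ^ (d * suc i)) (f 0 ^ j) _ ⟨
  f 0 ^ (d * suc i) * f 0 ^ j * (f (suc i) ^ i) ^ j
    ≡⟨ cong₂ _*_ (trans (sym (^-distribˡ-+-* (f 0) (d * suc i) j)) (cong (f 0 ^_) (exponent j d)))
                 (^-swap (f (suc i)) i j) ⟩
  f 0 ^ (suc d * i) * (f (suc i) ^ j) ^ i    ≡⟨ cong (_* (f (suc i) ^ j) ^ i) (^-*-assoc (f 0) (suc d) i) ⟨
  (f 0 ^ suc d) ^ i * (f (suc i) ^ j) ^ i    ≡⟨ ^-distribʳ-* (f 0 ^ suc d) (f (suc i) ^ j) i ⟨
  (f 0 ^ suc d * f (suc i) ^ j) ^ i          ∎)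
  where
  open ≤-Reasoning
  i : ℕ
  i = j + d
  exponent : ∀ j d → d * suc (j + d) + j ≡ suc d * (j + d)
  exponent = solve-∀

-- The shift by one is the one in f i = tr M^(2i+2).
Submultiplicative : (ℕ → ℕ) → Set
Submultiplicative f = ∀ i j → f (suc (i + j)) ≤ f i * f j

submultiplicative-multiple : ∀ f → Submultiplicative f →
  ∀ i t → f (i + t * suc i) ≤ f i ^ suc t
submultiplicative-multiple f sub i zero rewrite +-identityʳ i = ≤-reflexive (sym (*-identityʳ (f i)))
submultiplicative-multiple f sub i (suc t) = begin
  f (i + (suc i + t * suc i))   ≡⟨ cong f (+-suc i (i + t * suc i)) ⟩
  f (suc (i + (i + t * suc i))) ≤⟨ sub i (i + t * suc i) ⟩
  f i * f (i + t * suc i)       ≤⟨ *-monoʳ-≤ (f i) (submultiplicative-multiple f sub i t) ⟩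
  f i * f i ^ suc t             ∎
  where open ≤-Reasoning

-- With f i = Σ λ^(2i+2), this says that the ℓ^p-norm of (λ) decreases in p.
-- By convexity log f lies below its chord from i to a far multiple of i, and
-- submultiplicativity puts that chord below the line through the origin.
norm-antitone : ∀ f → LogConvex f → Submultiplicative f →
  ∀ {i j} → i ≤ j → f j ^ suc i ≤ f i ^ suc j
norm-antitone f lc sub {i} i≤j with e , refl ← m≤n⇒∃[o]m+o≡n i≤j = ^-cancelˡ-≤ (i + e) (begin
  (f j ^ suc i) ^ suc j            ≡⟨ ^-*-assoc (f j) (suc i) (suc j) ⟩
  f j ^ (suc i * suc j)            ≡⟨ cong (f j ^_) (split i e) ⟩
  f j ^ (e + d)                    ≤⟨ logConvex-interpolate (λ t → f (i + t)) lc′ e d ⟩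
  f (i + 0) ^ d * f (i + (e + d)) ^ e ≡⟨ cong₂ (λ u v → f u ^ d * f v ^ e) (+-identityʳ i) (cong (i +_) (far i e)) ⟩
  f i ^ d * f (i + suc j * suc i) ^ e
    ≤⟨ *-monoʳ-≤ (f i ^ d) (^-monoˡ-≤ e (submultiplicative-multiple f sub i (suc j))) ⟩
  f i ^ d * (f i ^ suc (suc j)) ^ e ≡⟨ cong (f i ^ d *_) (^-*-assoc (f i) (suc (suc j)) e) ⟩
  f i ^ d * f i ^ (suc (suc j) * e) ≡⟨ ^-distribˡ-+-* (f i) d (suc (suc j) * e) ⟨
  f i ^ (d + suc (suc j) * e)      ≡⟨ cong (f i ^_) (square i e) ⟩
  f i ^ (suc j * suc j)            ≡⟨ ^-*-assoc (f i) (suc j) (suc j) ⟨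
  (f i ^ suc j) ^ suc j            ∎)
  where
  open ≤-Reasoning
  j d : ℕ
  j = i + e
  -- Chosen so that `e + d` is `suc i * suc j`. The chord then ends at `i + suc j * suc i`, which
  -- stands for the exponent `suc (suc j)` times that of `i`.
  d = i * suc (i + e) + suc i
  lc′ : LogConvex (λ t → f (i + t))
  lc′ t rewrite +-suc i (suc t) | +-suc i t = lc (i + t)
  split : ∀ i e → suc i * suc (i + e) ≡ e + (i * suc (i + e) + suc i)
  split = solve-∀
  far : ∀ i e → e + (i * suc (i + e) + suc i) ≡ suc (i + e) * suc i
  far = solve-∀
  square : ∀ i e → i * suc (i + e) + suc i + suc (suc (i + e)) * e ≡ suc (i + e) * suc (i + e)
  square = solve-∀

-- Finite sums and traces of matrix powers

private variable
  I J : Set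

∑ : List I → (I → ℕ) → ℕ
∑ xs f = sum (map f xs)

∑-cong : ∀ (xs : List I) {f g : I → ℕ} → (∀ x → f x ≡ g x) → ∑ xs f ≡ ∑ xs g
∑-cong []       f≡g = refl
∑-cong (x ∷ xs) f≡g = cong₂ _+_ (f≡g x) (∑-cong xs f≡g)

∑-mono-≤ : ∀ (xs : List I) {f g : I → ℕ} → (∀ x → f x ≤ g x) → ∑ xs f ≤ ∑ xs g
∑-mono-≤ []       f≤g = z≤n
∑-mono-≤ (x ∷ xs) f≤g = +-mono-≤ (f≤g x) (∑-mono-≤ xs f≤g)

∑-zero : ∀ (xs : List I) → ∑ xs (λ _ → 0) ≡ 0
∑-zero []       = refl
∑-zero (x ∷ xs) = ∑-zero xs

∑-one : ∀ (xs : List I) → ∑ xs (λ _ → 1) ≡ length xs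
∑-one []       = refl
∑-one (x ∷ xs) = cong suc (∑-one xs)

∑-distrib-+ : ∀ (xs : List I) (f g : I → ℕ) → ∑ xs (λ x → f x + g x) ≡ ∑ xs f + ∑ xs g
∑-distrib-+ []       f g = refl
∑-distrib-+ (x ∷ xs) f g rewrite ∑-distrib-+ xs f g =
  [m+n]+[o+p]≡[m+o]+[n+p] (f x) (g x) (∑ xs f) (∑ xs g)
  where
  [m+n]+[o+p]≡[m+o]+[n+p] : ∀ m n o p → (m + n) + (o + p) ≡ (m + o) + (n + p)
  [m+n]+[o+p]≡[m+o]+[n+p] = solve-∀

*-distribˡ-∑ : ∀ (xs : List I) c (f : I → ℕ) → c * ∑ xs f ≡ ∑ xs (λ x → c * f x)
*-distribˡ-∑ []       c f = *-zeroʳ c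
*-distribˡ-∑ (x ∷ xs) c f =
  trans (*-distribˡ-+ c (f x) (∑ xs f)) (cong (c * f x +_) (*-distribˡ-∑ xs c f))

*-distribʳ-∑ : ∀ (xs : List I) c (f : I → ℕ) → ∑ xs f * c ≡ ∑ xs (λ x → f x * c)
*-distribʳ-∑ xs c f =
  trans (*-comm (∑ xs f) c) (trans (*-distribˡ-∑ xs c f) (∑-cong xs λ x → *-comm c (f x)))

∑-comm : ∀ (xs : List I) (ys : List J) (f : I → J → ℕ) →
  ∑ xs (λ x → ∑ ys (f x)) ≡ ∑ ys (λ y → ∑ xs (λ x → f x y))
∑-comm []       ys f = sym (∑-zero ys)
∑-comm (x ∷ xs) ys f =
  trans (cong (∑ ys (f x) +_) (∑-comm xs ys f)) (sym (∑-distrib-+ ys (f x) _))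

∑-++ : ∀ (xs ys : List I) (f : I → ℕ) → ∑ (xs ++ ys) f ≡ ∑ xs f + ∑ ys f
∑-++ xs ys f = trans (cong sum (map-++ f xs ys)) (sum-++ (map f xs) (map f ys))

∑-map : ∀ (xs : List I) (g : I → J) (f : J → ℕ) → ∑ (map g xs) f ≡ ∑ xs (λ x → f (g x))
∑-map xs g f = cong sum (sym (map-∘ xs))

∑-cartesianProduct : ∀ (xs : List I) (ys : List J) (f : I × J → ℕ) →
  ∑ (cartesianProduct xs ys) f ≡ ∑ xs (λ x → ∑ ys (λ y → f (x , y)))
∑-cartesianProduct []       ys f = refl
∑-cartesianProduct (x ∷ xs) ys f =
  trans (∑-++ (map (x ,_) ys) (cartesianProduct xs ys) f)
        (cong₂ _+_ (∑-map ys (x ,_) f) (∑-cartesianProduct xs ys f))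

∑-concatMap : ∀ (g : I → List J) (xs : List I) (F : J → ℕ) →
  ∑ (concatMap g xs) F ≡ ∑ xs λ x → ∑ (g x) F
∑-concatMap g []       F = refl
∑-concatMap g (x ∷ xs) F = trans (∑-++ (g x) (concatMap g xs) F) (cong (∑ (g x) F +_) (∑-concatMap g xs F))

∑*∑ : ∀ (xs : List I) (ys : List J) (f : I → ℕ) (g : J → ℕ) →
  ∑ xs f * ∑ ys g ≡ ∑ xs (λ x → ∑ ys (λ y → f x * g y))
∑*∑ xs ys f g = trans (*-distribʳ-∑ xs (∑ ys g) f) (∑-cong xs λ x → *-distribˡ-∑ ys (f x) g)

-- Induction on the list. The cross term 2abs is compared with a²G + b²F after squaring, from s² ≤
-- FG and 4xy ≤ (x + y)², so no subtraction occurs.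
cauchySchwarz : ∀ (xs : List I) (f g : I → ℕ) →
  ∑ xs (λ x → f x * g x) * ∑ xs (λ x → f x * g x) ≤
  ∑ xs (λ x → f x * f x) * ∑ xs (λ x → g x * g x)
cauchySchwarz []       f g = z≤n
cauchySchwarz (x ∷ xs) f g = begin
  (a * b + s) * (a * b + s)                   ≡⟨ expand a b s ⟩
  a * a * (b * b) + 2 * (a * b * s) + s * s   ≤⟨ +-mono-≤ (+-monoʳ-≤ (a * a * (b * b)) cross) ih ⟩
  a * a * (b * b) + (a * a * G + b * b * F) + F * G ≡⟨ collect a b F G ⟩
  (a * a + F) * (b * b + G)                   ∎
  where
  open ≤-Reasoning
  a b s F G : ℕ
  a = f x
  b = g x
  s = ∑ xs (λ x → f x * g x)
  F = ∑ xs (λ x → f x * f x)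
  G = ∑ xs (λ x → g x * g x)
  ih : s * s ≤ F * G
  ih = cauchySchwarz xs f g
  expand : ∀ a b s → (a * b + s) * (a * b + s) ≡ a * a * (b * b) + 2 * (a * b * s) + s * s
  expand = solve-∀
  collect : ∀ a b F G → a * a * (b * b) + (a * a * G + b * b * F) + F * G ≡ (a * a + F) * (b * b + G)
  collect = solve-∀
  square₁ : ∀ a b s → 2 * (a * b * s) * (2 * (a * b * s) * 1) ≡ 4 * (a * a * (b * b)) * (s * s)
  square₁ = solve-∀
  square₂ : ∀ a b F G → 4 * (a * a * (b * b)) * (F * G) ≡ 4 * (a * a * G * (b * b * F))
  square₂ = solve-∀
  cross : 2 * (a * b * s) ≤ a * a * G + b * b * F
  cross = ^-cancelˡ-≤ 1 (begin
    (2 * (a * b * s)) ^ 2               ≡⟨ square₁ a b s ⟩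
    4 * (a * a * (b * b)) * (s * s)     ≤⟨ *-monoʳ-≤ (4 * (a * a * (b * b))) ih ⟩
    4 * (a * a * (b * b)) * (F * G)     ≡⟨ square₂ a b F G ⟩
    4 * (a * a * G * (b * b * F))       ≤⟨ 4xy≤[x+y]² (a * a * G) (b * b * F) ⟩
    (a * a * G + b * b * F) * (a * a * G + b * b * F) ≡⟨ cong ((a * a * G + b * b * F) *_) (*-identityʳ _) ⟨
    (a * a * G + b * b * F) ^ 2         ∎)

-- Matrices with natural number entries

Matrix : Set → Set
Matrix I = I → I → ℕ

Symmetric : Matrix I → Set
Symmetric M = ∀ x y → M x y ≡ M y x

_≤ₘ_ : Matrix I → Matrix I → Set
M ≤ₘ N = ∀ x y → M x y ≤ N x y

≤ₘ-refl : (P : Matrix I) → P ≤ₘ P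
≤ₘ-refl P x y = ≤-refl

-- Because of the shift in `pow`, `pow M (2^ s ∸1)` is M^(2^s), and one step of this recursion
-- squares the matrix.
2^_∸1 : ℕ → ℕ
2^ zero  ∸1 = 0
2^ suc s ∸1 = suc (2^ s ∸1 + 2^ s ∸1)

s≤2^s∸1 : ∀ s → s ≤ 2^ s ∸1
s≤2^s∸1 zero    = z≤n
s≤2^s∸1 (suc s) = s≤s (≤-trans (s≤2^s∸1 s) (m≤m+n _ _))

module MatrixOver {I : Set} (xs : List I) where

  -- The Frobenius inner product, that is, the trace of PᵀQ.
  ⟨_,_⟩ : Matrix I → Matrix I → ℕ
  ⟨ P , Q ⟩ = ∑ xs λ x → ∑ xs λ y → P x y * Q x y

  _⊡_ : Matrix I → Matrix I → Matrix I
  (P ⊡ Q) x y = ∑ xs λ z → P x z * Q z y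

  total : Matrix I → ℕ
  total P = ∑ xs λ x → ∑ xs λ y → P x y

  -- pow M i is M^(i+1); without decidable equality on I there is no identity matrix.
  pow : Matrix I → ℕ → Matrix I
  pow M zero    = M
  pow M (suc i) = M ⊡ pow M i

  -- For symmetric M, cyc M i is the trace of M^(i+2).
  cyc : Matrix I → ℕ → ℕ
  cyc M i = ⟨ M , pow M i ⟩

  ∑∑-cong : {P Q : Matrix I} → (∀ x y → P x y ≡ Q x y) → total P ≡ total Q
  ∑∑-cong P≡Q = ∑-cong xs λ x → ∑-cong xs λ y → P≡Q x y

  total-mono : {P Q : Matrix I} → P ≤ₘ Q → total P ≤ total Q
  total-mono P≤Q = ∑-mono-≤ xs λ x → ∑-mono-≤ xs λ y → P≤Q x y

  ⟨⟩-mono : {P P′ Q Q′ : Matrix I} → P ≤ₘ P′ → Q ≤ₘ Q′ → ⟨ P , Q ⟩ ≤ ⟨ P′ , Q′ ⟩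
  ⟨⟩-mono P≤ Q≤ = total-mono λ x y → *-mono-≤ (P≤ x y) (Q≤ x y)

  ⟨⟩-comm : (P Q : Matrix I) → ⟨ P , Q ⟩ ≡ ⟨ Q , P ⟩
  ⟨⟩-comm P Q = ∑∑-cong λ x y → *-comm (P x y) (Q x y)

  ⟨⟩-congʳ : {P Q Q′ : Matrix I} → (∀ x y → Q x y ≡ Q′ x y) → ⟨ P , Q ⟩ ≡ ⟨ P , Q′ ⟩
  ⟨⟩-congʳ {P} Q≡ = ∑∑-cong λ x y → cong (P x y *_) (Q≡ x y)

  ⊡-mono : {P P′ Q Q′ : Matrix I} → P ≤ₘ P′ → Q ≤ₘ Q′ → (P ⊡ Q) ≤ₘ (P′ ⊡ Q′)
  ⊡-mono P≤ Q≤ x y = ∑-mono-≤ xs λ z → *-mono-≤ (P≤ x z) (Q≤ z y)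

  ⊡-assoc : (P Q R : Matrix I) → ∀ x y → ((P ⊡ Q) ⊡ R) x y ≡ (P ⊡ (Q ⊡ R)) x y
  ⊡-assoc P Q R x y = begin
    ∑ xs (λ z → ∑ xs (λ w → P x w * Q w z) * R z y)   ≡⟨ (∑-cong xs λ z → *-distribʳ-∑ xs (R z y) _) ⟩
    ∑ xs (λ z → ∑ xs (λ w → P x w * Q w z * R z y))   ≡⟨ ∑-comm xs xs _ ⟩
    ∑ xs (λ w → ∑ xs (λ z → P x w * Q w z * R z y))   ≡⟨ (∑-cong xs λ w → ∑-cong xs λ z → *-assoc (P x w) (Q w z) (R z y)) ⟩
    ∑ xs (λ w → ∑ xs (λ z → P x w * (Q w z * R z y))) ≡⟨ (∑-cong xs λ w → *-distribˡ-∑ xs (P x w) _) ⟨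
    ∑ xs (λ w → P x w * ∑ xs (λ z → Q w z * R z y))   ∎
    where open ≡-Reasoning

  pow-mono : {M N : Matrix I} → M ≤ₘ N → ∀ i → pow M i ≤ₘ pow N i
  pow-mono M≤N zero    = M≤N
  pow-mono M≤N (suc i) = ⊡-mono M≤N (pow-mono M≤N i)

  pow-scale : {M N : Matrix I} (S : ℕ) → (∀ x y → M x y ≤ S * N x y) →
    ∀ i x y → pow M i x y ≤ S ^ suc i * pow N i x y
  pow-scale {M} {N} S M≤SN zero    x y = subst (λ u → M x y ≤ u * N x y) (sym (*-identityʳ S)) (M≤SN x y)
  pow-scale {M} {N} S M≤SN (suc i) x y = begin
    ∑ xs (λ z → M x z * pow M i z y)                     ≤⟨ (∑-mono-≤ xs λ z → *-mono-≤ (M≤SN x z) (pow-scale S M≤SN i z y)) ⟩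
    ∑ xs (λ z → S * N x z * (S ^ suc i * pow N i z y))   ≡⟨ (∑-cong xs λ z → [m*n]*[o*p]≡[m*o]*[n*p] S (N x z) (S ^ suc i) (pow N i z y)) ⟩
    ∑ xs (λ z → S ^ suc (suc i) * (N x z * pow N i z y)) ≡⟨ *-distribˡ-∑ xs (S ^ suc (suc i)) _ ⟨
    S ^ suc (suc i) * pow N (suc i) x y                  ∎
    where open ≤-Reasoning

  pow-⊡ : (M : Matrix I) → ∀ i j x y → (pow M i ⊡ pow M j) x y ≡ pow M (suc (i + j)) x y
  pow-⊡ M zero    j x y = refl
  pow-⊡ M (suc i) j x y =
    trans (⊡-assoc M (pow M i) (pow M j) x y) (∑-cong xs λ z → cong (M x z *_) (pow-⊡ M i j z y))

  pow-symmetric : {M : Matrix I} → Symmetric M → ∀ i → Symmetric (pow M i)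
  pow-symmetric {M} sm zero    = sm
  pow-symmetric {M} sm (suc i) x y = begin
    ∑ xs (λ z → M x z * pow M i z y) ≡⟨ (∑-cong xs λ z → trans (cong₂ _*_ (sm x z) (pow-symmetric sm i z y)) (*-comm (M z x) _)) ⟩
    (pow M i ⊡ pow M 0) y x          ≡⟨ pow-⊡ M i 0 y x ⟩
    pow M (suc (i + 0)) y x          ≡⟨ cong (λ j → pow M (suc j) y x) (+-identityʳ i) ⟩
    pow M (suc i) y x                ∎
    where open ≡-Reasoning

  ⊡-adjoint : {M : Matrix I} → Symmetric M → (P Q : Matrix I) → ⟨ M ⊡ P , Q ⟩ ≡ ⟨ P , M ⊡ Q ⟩
  ⊡-adjoint {M} sm P Q = begin
    ∑ xs (λ x → ∑ xs λ y → ∑ xs (λ z → M x z * P z y) * Q x y)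
      ≡⟨ ∑∑-cong (λ x y → *-distribʳ-∑ xs (Q x y) _) ⟩
    ∑ xs (λ x → ∑ xs λ y → ∑ xs λ z → M x z * P z y * Q x y)
      ≡⟨ (∑-cong xs λ x → ∑-comm xs xs _) ⟩
    ∑ xs (λ x → ∑ xs λ z → ∑ xs λ y → M x z * P z y * Q x y)
      ≡⟨ ∑-comm xs xs _ ⟩
    ∑ xs (λ z → ∑ xs λ x → ∑ xs λ y → M x z * P z y * Q x y)
      ≡⟨ (∑-cong xs λ z → ∑-comm xs xs _) ⟩
    ∑ xs (λ z → ∑ xs λ y → ∑ xs λ x → M x z * P z y * Q x y)
      ≡⟨ ∑∑-cong (λ z y → ∑-cong xs λ x → trans (cong (λ u → u * P z y * Q x y) (sm x z)) (rearrange (M z x) (P z y) (Q x y))) ⟩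
    ∑ xs (λ z → ∑ xs λ y → ∑ xs λ x → P z y * (M z x * Q x y))
      ≡⟨ ∑∑-cong (λ z y → *-distribˡ-∑ xs (P z y) _) ⟨
    ∑ xs (λ z → ∑ xs λ y → P z y * ∑ xs (λ x → M z x * Q x y)) ∎
    where
    open ≡-Reasoning
    rearrange : ∀ m p q → m * p * q ≡ p * (m * q)
    rearrange = solve-∀

  -- Rotates a closed walk: the factor `P` on the right of `N` moves to the other side, which leaves
  -- `N` alone in front.
  ⟨⊡,⟩ : (N P Q : Matrix I) → Symmetric P → ⟨ N ⊡ P , Q ⟩ ≡ ⟨ N , Q ⊡ P ⟩
  ⟨⊡,⟩ N P Q sp = ∑-cong xs λ x → begin
    ∑ xs (λ y → ∑ xs (λ z → N x z * P z y) * Q x y)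
      ≡⟨ (∑-cong xs λ y → *-distribʳ-∑ xs (Q x y) _) ⟩
    ∑ xs (λ y → ∑ xs λ z → N x z * P z y * Q x y)
      ≡⟨ ∑-comm xs xs _ ⟩
    ∑ xs (λ z → ∑ xs λ y → N x z * P z y * Q x y)
      ≡⟨ (∑-cong xs λ z → ∑-cong xs λ y → trans (cong (λ u → N x z * u * Q x y) (sp z y)) (rearrange (N x z) (P y z) (Q x y))) ⟩
    ∑ xs (λ z → ∑ xs λ y → N x z * (Q x y * P y z))
      ≡⟨ (∑-cong xs λ z → *-distribˡ-∑ xs (N x z) _) ⟨
    ∑ xs (λ z → N x z * ∑ xs (λ y → Q x y * P y z)) ∎
    where
    open ≡-Reasoning
    rearrange : ∀ n p q → n * p * q ≡ n * (q * p)
    rearrange = solve-∀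

  -- Self-adjointness of multiplication by M moves the factors across one at a time, so only the
  -- total exponent matters.
  ⟨pow,pow⟩ : {M : Matrix I} → Symmetric M → ∀ i j → ⟨ pow M i , pow M j ⟩ ≡ cyc M (i + j)
  ⟨pow,pow⟩ {M} sm zero    j = refl
  ⟨pow,pow⟩ {M} sm (suc i) j =
    trans (⊡-adjoint sm (pow M i) (pow M j))
          (trans (⟨pow,pow⟩ sm i (suc j)) (cong (cyc M) (+-suc i j)))

  ⟨⟩-cauchySchwarz : (P Q : Matrix I) → ⟨ P , Q ⟩ * ⟨ P , Q ⟩ ≤ ⟨ P , P ⟩ * ⟨ Q , Q ⟩
  ⟨⟩-cauchySchwarz P Q =
    subst₂ _≤_ (cong₂ _*_ (flat P Q) (flat P Q)) (cong₂ _*_ (flat P P) (flat Q Q))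
      (cauchySchwarz (cartesianProduct xs xs) (uncurry P) (uncurry Q))
    where
    flat : ∀ R R′ → ∑ (cartesianProduct xs xs) (λ p → uncurry R p * uncurry R′ p) ≡ ⟨ R , R′ ⟩
    flat R R′ = ∑-cartesianProduct xs xs _
  
  cyc-cauchySchwarz : {M : Matrix I} → Symmetric M → ∀ i j →
    cyc M (i + j) * cyc M (i + j) ≤ cyc M (i + i) * cyc M (j + j)
  cyc-cauchySchwarz {M} sm i j
    rewrite sym (⟨pow,pow⟩ sm i j) | sym (⟨pow,pow⟩ sm i i) | sym (⟨pow,pow⟩ sm j j) =
    ⟨⟩-cauchySchwarz (pow M i) (pow M j)

  -- For symmetric M this is tr M^(2i+2) = Σ λ^(2i+2) over the eigenvalues, a power of a Schatten
  -- norm.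
  evenCyc : Matrix I → ℕ → ℕ
  evenCyc M i = cyc M (i + i)

  evenCyc-logConvex : {M : Matrix I} → Symmetric M → LogConvex (evenCyc M)
  evenCyc-logConvex {M} sm i =
    subst (λ j → cyc M j * cyc M j ≤ evenCyc M i * evenCyc M (suc (suc i)))
          (solve i) (cyc-cauchySchwarz sm i (suc (suc i)))
    where
    solve : ∀ i → i + suc (suc i) ≡ suc i + suc i
    solve = solve-∀

  -- tr M^(2i+2j+4) is the squared Frobenius norm of the product of M^(i+1) and M^(j+1). That norm
  -- is submultiplicative by Cauchy-Schwarz in each entry of the product.
  evenCyc-submultiplicative : {M : Matrix I} → Symmetric M → Submultiplicative (evenCyc M)
  evenCyc-submultiplicative {M} sm i j = begin
    cyc M (suc (i + j) + suc (i + j))           ≡⟨ ⟨pow,pow⟩ sm (suc (i + j)) (suc (i + j)) ⟨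
    total (λ x y → pow M (suc (i + j)) x y * pow M (suc (i + j)) x y)
      ≡⟨ ∑∑-cong (λ x y → cong₂ _*_ (pow-⊡ M i j x y) (pow-⊡ M i j x y)) ⟨
    total (λ x y → (pow M i ⊡ pow M j) x y * (pow M i ⊡ pow M j) x y)
      ≤⟨ total-mono (λ x y → cauchySchwarz xs (pow M i x) (λ z → pow M j z y)) ⟩
    total (λ x y → ∑ xs (λ z → pow M i x z * pow M i x z) * ∑ xs (λ z → pow M j z y * pow M j z y))
      ≡⟨ ∑*∑ xs xs _ _ ⟨
    ⟨ pow M i , pow M i ⟩ * ∑ xs (λ y → ∑ xs (λ z → pow M j z y * pow M j z y))
      ≡⟨ cong (⟨ pow M i , pow M i ⟩ *_) (∑-comm xs xs _) ⟩
    ⟨ pow M i , pow M i ⟩ * ⟨ pow M j , pow M j ⟩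
      ≡⟨ cong₂ _*_ (⟨pow,pow⟩ sm i i) (⟨pow,pow⟩ sm j j) ⟩
    evenCyc M i * evenCyc M j ∎
    where open ≤-Reasoning

  evenCyc-antitone : {M : Matrix I} → Symmetric M → ∀ {i j} → i ≤ j →
    evenCyc M j ^ suc i ≤ evenCyc M i ^ suc j
  evenCyc-antitone {M} sm = norm-antitone (evenCyc M) (evenCyc-logConvex sm) (evenCyc-submultiplicative sm)

  -- Cauchy-Schwarz applied to the row sums against the constant 1. By symmetry the squares of the
  -- row sums add up to the total of P².
  total-square : {P : Matrix I} → Symmetric P → total P * total P ≤ length xs * total (P ⊡ P)
  total-square {P} sp = begin
    total P * total P
      ≡⟨ cong (λ u → u * u) (∑-cong xs λ x → *-identityˡ (∑ xs (P x))) ⟨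
    ∑ xs (λ x → 1 * ∑ xs (P x)) * ∑ xs (λ x → 1 * ∑ xs (P x))
      ≤⟨ cauchySchwarz xs (λ _ → 1) (λ x → ∑ xs (P x)) ⟩
    ∑ xs (λ _ → 1) * ∑ xs (λ x → ∑ xs (P x) * ∑ xs (P x))
      ≡⟨ cong₂ _*_ (∑-one xs) rowSquares ⟩
    length xs * total (P ⊡ P) ∎
    where
    open ≤-Reasoning
    rowSquares : ∑ xs (λ x → ∑ xs (P x) * ∑ xs (P x)) ≡ total (P ⊡ P)
    rowSquares = begin-equality
      ∑ xs (λ x → ∑ xs (P x) * ∑ xs (P x))            ≡⟨ (∑-cong xs λ x → ∑*∑ xs xs (P x) (P x)) ⟩
      ∑ xs (λ x → ∑ xs λ y → ∑ xs λ z → P x y * P x z) ≡⟨ ∑-comm xs xs _ ⟩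
      ∑ xs (λ y → ∑ xs λ x → ∑ xs λ z → P x y * P x z) ≡⟨ (∑-cong xs λ y → ∑-comm xs xs _) ⟩
      ∑ xs (λ y → ∑ xs λ z → ∑ xs λ x → P x y * P x z) ≡⟨ ∑∑-cong (λ y z → ∑-cong xs λ x → cong (_* P x z) (sp x y)) ⟩
      total (P ⊡ P)                                   ∎

  total²≤length²*⟨⟩ : (P : Matrix I) → total P * total P ≤ length xs * length xs * ⟨ P , P ⟩
  total²≤length²*⟨⟩ P = begin
    total P * total P               ≡⟨ cong (λ u → u * u) (∑∑-cong λ x y → *-identityˡ (P x y)) ⟨
    ⟨ (λ _ _ → 1) , P ⟩ * ⟨ (λ _ _ → 1) , P ⟩ ≤⟨ ⟨⟩-cauchySchwarz (λ _ _ → 1) P ⟩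
    ⟨ (λ _ _ → 1) , (λ _ _ → 1) ⟩ * ⟨ P , P ⟩ ≡⟨ cong (_* ⟨ P , P ⟩) ones ⟩
    length xs * length xs * ⟨ P , P ⟩ ∎
    where
    open ≤-Reasoning
    ones : total (λ _ _ → 1) ≡ length xs * length xs
    ones = trans (sym (∑*∑ xs xs (λ _ → 1) (λ _ → 1))) (cong₂ _*_ (∑-one xs) (∑-one xs))

  -- The Sidorenko inequality for the path with 2^s edges: each application of `total-square`
  -- doubles its length.
  total-pow2 : {M : Matrix I} → Symmetric M → ∀ s →
    total M ^ suc (2^ s ∸1) ≤ length xs ^ 2^ s ∸1 * total (pow M 2^ s ∸1)
  total-pow2 {M} sm zero = ≤-reflexive (trans (*-identityʳ (total M)) (sym (*-identityˡ (total M))))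
  total-pow2 {M} sm (suc s) = begin
    total M ^ suc (suc (d + d))               ≡⟨ cong (λ u → total M ^ suc u) (+-suc d d) ⟨
    total M ^ (suc d + suc d)                 ≡⟨ ^-distribˡ-+-* (total M) (suc d) (suc d) ⟩
    total M ^ suc d * total M ^ suc d         ≤⟨ *-mono-≤ (total-pow2 sm s) (total-pow2 sm s) ⟩
    n ^ d * t * (n ^ d * t)                   ≡⟨ [m*n]*[o*p]≡[m*o]*[n*p] (n ^ d) t (n ^ d) t ⟩
    n ^ d * n ^ d * (t * t)                   ≤⟨ *-monoʳ-≤ (n ^ d * n ^ d) (total-square (pow-symmetric sm d)) ⟩
    n ^ d * n ^ d * (n * total (pow M d ⊡ pow M d))
      ≡⟨ cong₂ (λ u v → u * (n * v)) (sym (^-distribˡ-+-* n d d)) (∑∑-cong (pow-⊡ M d d)) ⟩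
    n ^ (d + d) * (n * total (pow M (suc (d + d)))) ≡⟨ rearrange (n ^ (d + d)) n _ ⟩
    n ^ suc (d + d) * total (pow M (suc (d + d)))   ∎
    where
    open ≤-Reasoning
    d n t : ℕ
    d = 2^ s ∸1
    n = length xs
    t = total (pow M d)
    rearrange : ∀ a b c → a * (b * c) ≡ b * a * c
    rearrange = solve-∀

  -- The Sidorenko inequality for even cycles.
  total-evenCyc : {M : Matrix I} → Symmetric M → ∀ i →
    (total M * total M) ^ suc i ≤ (length xs * length xs) ^ suc i * evenCyc M i
  -- The inequality is first proved at `d = 2^ i ∸1`, where repeated squaring applies. It descends
  -- to `i ≤ d` because Schatten norms decrease in the exponent; a root of order `suc d` is taken at
  -- the end.
  total-evenCyc {M} sm i = ^-cancelˡ-≤ d (begin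
    ((t * t) ^ suc i) ^ suc d                 ≡⟨ ^-swap (t * t) (suc i) (suc d) ⟩
    ((t * t) ^ suc d) ^ suc i                 ≤⟨ ^-monoˡ-≤ (suc i) atPow2 ⟩
    ((n * n) ^ suc d * evenCyc M d) ^ suc i   ≡⟨ ^-distribʳ-* ((n * n) ^ suc d) (evenCyc M d) (suc i) ⟩
    ((n * n) ^ suc d) ^ suc i * evenCyc M d ^ suc i
      ≤⟨ *-mono-≤ (≤-reflexive (^-swap (n * n) (suc d) (suc i))) (evenCyc-antitone sm (s≤2^s∸1 i)) ⟩
    ((n * n) ^ suc i) ^ suc d * evenCyc M i ^ suc d ≡⟨ ^-distribʳ-* ((n * n) ^ suc i) (evenCyc M i) (suc d) ⟨
    ((n * n) ^ suc i * evenCyc M i) ^ suc d   ∎)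
    where
    open ≤-Reasoning
    d n t u : ℕ
    d = 2^ i ∸1
    n = length xs
    t = total M
    u = total (pow M d)
    atPow2 : (t * t) ^ suc d ≤ (n * n) ^ suc d * evenCyc M d
    atPow2 = begin
      (t * t) ^ suc d                    ≡⟨ ^-distribʳ-* t t (suc d) ⟩
      t ^ suc d * t ^ suc d              ≤⟨ *-mono-≤ (total-pow2 sm i) (total-pow2 sm i) ⟩
      n ^ d * u * (n ^ d * u)            ≡⟨ [m*n]*[o*p]≡[m*o]*[n*p] (n ^ d) u (n ^ d) u ⟩
      n ^ d * n ^ d * (u * u)            ≤⟨ *-monoʳ-≤ (n ^ d * n ^ d) (total²≤length²*⟨⟩ (pow M d)) ⟩
      n ^ d * n ^ d * (n * n * ⟨ pow M d , pow M d ⟩)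
        ≡⟨ cong₂ (λ v w → v * (n * n * w)) (sym (^-distribʳ-* n n d)) (⟨pow,pow⟩ sm d d) ⟩
      (n * n) ^ d * (n * n * evenCyc M d) ≡⟨ rearrange ((n * n) ^ d) (n * n) (evenCyc M d) ⟩
      (n * n) ^ suc d * evenCyc M d      ∎
      where
      rearrange : ∀ a b c → a * (b * c) ≡ b * a * c
      rearrange = solve-∀

  ⟨+,⟩ : (P P′ Q : Matrix I) →
    ⟨ (λ x y → P x y + P′ x y) , Q ⟩ ≡ ⟨ P , Q ⟩ + ⟨ P′ , Q ⟩
  ⟨+,⟩ P P′ Q = begin
    ∑ xs (λ x → ∑ xs λ y → (P x y + P′ x y) * Q x y)
      ≡⟨ ∑∑-cong (λ x y → *-distribʳ-+ (Q x y) (P x y) (P′ x y)) ⟩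
    ∑ xs (λ x → ∑ xs λ y → P x y * Q x y + P′ x y * Q x y)
      ≡⟨ (∑-cong xs λ x → ∑-distrib-+ xs _ _) ⟩
    ∑ xs (λ x → ∑ xs (λ y → P x y * Q x y) + ∑ xs (λ y → P′ x y * Q x y))
      ≡⟨ ∑-distrib-+ xs _ _ ⟩
    ⟨ P , Q ⟩ + ⟨ P′ , Q ⟩ ∎
    where open ≡-Reasoning

  ⊡-+ : (P P′ Q : Matrix I) → ∀ x y →
    ((λ x y → P x y + P′ x y) ⊡ Q) x y ≡ (P ⊡ Q) x y + (P′ ⊡ Q) x y
  ⊡-+ P P′ Q x y =
    trans (∑-cong xs λ z → *-distribʳ-+ (Q z y) (P x z) (P′ x z)) (∑-distrib-+ xs _ _)

  -- Closed walks under a splitting of the edges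

  module _ {A A′ A″ : Matrix I} (sA : Symmetric A) (split : ∀ x y → A x y ≡ A′ x y + A″ x y) where

    private
      A′≤A : A′ ≤ₘ A
      A′≤A x y = subst (A′ x y ≤_) (sym (split x y)) (m≤m+n (A′ x y) (A″ x y))

    ⟨A,⟩-split : (Q : Matrix I) → ⟨ A , Q ⟩ ≡ ⟨ A′ , Q ⟩ + ⟨ A″ , Q ⟩
    ⟨A,⟩-split Q = trans (∑∑-cong λ x y → cong (_* Q x y) (split x y)) (⟨+,⟩ A′ A″ Q)

    -- The factors A of the first power are replaced by A′ one at a time. Each replacement costs the
    -- walks with an A″ edge in that position, and these are at most ⟨ A″ , A^(i+j+1) ⟩.
    pow-telescope : ∀ i j →
      ⟨ pow A i , pow A j ⟩ ≤ ⟨ pow A′ i , pow A j ⟩ + suc i * ⟨ A″ , pow A (i + j) ⟩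
    pow-telescope zero j = ≤-reflexive
      (trans (⟨A,⟩-split (pow A j)) (cong (⟨ A′ , pow A j ⟩ +_) (sym (*-identityˡ _))))
    pow-telescope (suc i) j = begin
      ⟨ pow A (suc i) , pow A j ⟩
        ≡⟨ ⊡-adjoint sA (pow A i) (pow A j) ⟩
      ⟨ pow A i , pow A (suc j) ⟩
        ≤⟨ pow-telescope i (suc j) ⟩
      ⟨ pow A′ i , pow A (suc j) ⟩ + suc i * ⟨ A″ , pow A (i + suc j) ⟩
        ≡⟨ cong₂ (λ u v → u + suc i * ⟨ A″ , pow A v ⟩) (sym (⊡-adjoint sA (pow A′ i) (pow A j))) (+-suc i j) ⟩
      ⟨ A ⊡ pow A′ i , pow A j ⟩ + suc i * t
        ≡⟨ cong (_+ suc i * t) firstEdge ⟩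
      (⟨ pow A′ (suc i) , pow A j ⟩ + ⟨ A″ ⊡ pow A′ i , pow A j ⟩) + suc i * t
        ≤⟨ +-monoˡ-≤ (suc i * t) (+-monoʳ-≤ ⟨ pow A′ (suc i) , pow A j ⟩ marked) ⟩
      (⟨ pow A′ (suc i) , pow A j ⟩ + t) + suc i * t
        ≡⟨ +-assoc ⟨ pow A′ (suc i) , pow A j ⟩ t (suc i * t) ⟩
      ⟨ pow A′ (suc i) , pow A j ⟩ + suc (suc i) * t ∎
      where
      open ≤-Reasoning
      t : ℕ
      t = ⟨ A″ , pow A (suc (i + j)) ⟩
      firstEdge : ⟨ A ⊡ pow A′ i , pow A j ⟩ ≡
        ⟨ pow A′ (suc i) , pow A j ⟩ + ⟨ A″ ⊡ pow A′ i , pow A j ⟩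
      firstEdge = trans
        (∑∑-cong λ x y → cong (_* pow A j x y)
          (trans (∑-cong xs λ z → cong (_* pow A′ i z y) (split x z)) (⊡-+ A′ A″ (pow A′ i) x y)))
        (⟨+,⟩ (pow A′ (suc i)) (A″ ⊡ pow A′ i) (pow A j))
      -- Enlarge the remaining A′ edges to A, then rotate the closed walk so that the A″ edge stands
      -- alone.
      marked : ⟨ A″ ⊡ pow A′ i , pow A j ⟩ ≤ t
      marked = begin
        ⟨ A″ ⊡ pow A′ i , pow A j ⟩
          ≤⟨ ⟨⟩-mono {Q = pow A j} (⊡-mono {P = A″} (≤ₘ-refl A″) (pow-mono A′≤A i)) (≤ₘ-refl (pow A j)) ⟩
        ⟨ A″ ⊡ pow A i , pow A j ⟩
          ≡⟨ ⟨⊡,⟩ A″ (pow A i) (pow A j) (pow-symmetric sA i) ⟩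
        ⟨ A″ , pow A j ⊡ pow A i ⟩
          ≡⟨ ⟨⟩-congʳ {A″} (λ x y → trans (pow-⊡ A j i x y) (cong (λ u → pow A (suc u) x y) (+-comm j i))) ⟩
        t ∎

    -- A closed walk of length s + 2 either stays in A′ or has one of its s + 2 edges in A″.
    cyc-telescope : ∀ s → cyc A s ≤ cyc A′ s + suc (suc s) * ⟨ A″ , pow A s ⟩
    cyc-telescope s = begin
      ⟨ A , pow A s ⟩                                   ≡⟨ ⟨⟩-comm A (pow A s) ⟩
      ⟨ pow A s , A ⟩                                   ≤⟨ pow-telescope s 0 ⟩
      ⟨ pow A′ s , A ⟩ + suc s * ⟨ A″ , pow A (s + 0) ⟩ ≡⟨ cong₂ (λ u v → u + suc s * ⟨ A″ , pow A v ⟩) (⟨⟩-comm (pow A′ s) A) (+-identityʳ s) ⟩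
      ⟨ A , pow A′ s ⟩ + suc s * t                      ≡⟨ cong (_+ suc s * t) (⟨A,⟩-split (pow A′ s)) ⟩
      (cyc A′ s + ⟨ A″ , pow A′ s ⟩) + suc s * t     ≤⟨ +-monoˡ-≤ (suc s * t) (+-monoʳ-≤ (cyc A′ s) (⟨⟩-mono {A″} (≤ₘ-refl A″) (pow-mono A′≤A s))) ⟩
      (cyc A′ s + t) + suc s * t                      ≡⟨ +-assoc (cyc A′ s) t (suc s * t) ⟩
      cyc A′ s + suc (suc s) * t                      ∎
      where
      open ≤-Reasoning
      t : ℕ
      t = ⟨ A″ , pow A s ⟩

  -- Cauchy-Schwarz bounds the odd trace tr M^(2l+3) by its two even neighbours, after which the
  -- signs of the eigenvalues no longer matter.
  cyc-sq≤evenCyc : {M : Matrix I} → Symmetric M → ∀ l →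
    cyc M (suc (l + l)) * cyc M (suc (l + l)) ≤ evenCyc M l * evenCyc M (suc l)
  cyc-sq≤evenCyc {M} sm l =
    subst (λ u → cyc M u * cyc M u ≤ evenCyc M l * evenCyc M (suc l))
          (+-suc l l) (cyc-cauchySchwarz sm l (suc l))

  -- Monotonicity of Schatten norms, applied to both even neighbours of 2l + 3. It serves the range
  -- r ≤ 2ℓ, with r = 2m + 2 and ℓ = l + 1.
  cyc-antitone : {M : Matrix I} → Symmetric M → ∀ {m l} → m ≤ l →
    (cyc M (suc (l + l)) * cyc M (suc (l + l))) ^ suc m ≤ evenCyc M m ^ (suc l + suc (suc l))
  cyc-antitone {M} sm {m} {l} m≤l = begin
    (cyc M (suc (l + l)) * cyc M (suc (l + l))) ^ suc m ≤⟨ ^-monoˡ-≤ (suc m) (cyc-sq≤evenCyc sm l) ⟩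
    (evenCyc M l * evenCyc M (suc l)) ^ suc m           ≡⟨ ^-distribʳ-* (evenCyc M l) (evenCyc M (suc l)) (suc m) ⟩
    evenCyc M l ^ suc m * evenCyc M (suc l) ^ suc m
      ≤⟨ *-mono-≤ (evenCyc-antitone sm m≤l) (evenCyc-antitone sm (m≤n⇒m≤1+n m≤l)) ⟩
    evenCyc M m ^ suc l * evenCyc M m ^ suc (suc l)     ≡⟨ ^-distribˡ-+-* (evenCyc M m) (suc l) (suc (suc l)) ⟨
    evenCyc M m ^ (suc l + suc (suc l))                    ∎
    where open ≤-Reasoning

  -- Both even neighbours of 2l + 3 are interpolated between tr M² and tr M^(2m+2), where m = l + 1
  -- + d, and the two estimates are multiplied.
  cyc-interpolate : {M : Matrix I} → Symmetric M → ∀ l d →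
    (cyc M (suc (l + l)) * cyc M (suc (l + l))) ^ (suc l + d) ≤
    evenCyc M 0 ^ (suc d + d) * evenCyc M (suc l + d) ^ (l + suc l)
  cyc-interpolate {M} sm l d = begin
    (cyc M (suc (l + l)) * cyc M (suc (l + l))) ^ m ≤⟨ ^-monoˡ-≤ m (cyc-sq≤evenCyc sm l) ⟩
    (b l * b (suc l)) ^ m                     ≡⟨ ^-distribʳ-* (b l) (b (suc l)) m ⟩
    b l ^ m * b (suc l) ^ m
      ≤⟨ *-mono-≤ (subst (λ u → b l ^ u ≤ b 0 ^ suc d * b u ^ l) (+-suc l d) (logConvex-interpolate b lc l (suc d)))
                  (logConvex-interpolate b lc (suc l) d) ⟩
    b 0 ^ suc d * b m ^ l * (b 0 ^ d * b m ^ suc l) ≡⟨ [m*n]*[o*p]≡[m*o]*[n*p] (b 0 ^ suc d) (b m ^ l) (b 0 ^ d) (b m ^ suc l) ⟩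
    b 0 ^ suc d * b 0 ^ d * (b m ^ l * b m ^ suc l) ≡⟨ cong₂ _*_ (^-distribˡ-+-* (b 0) (suc d) d) (^-distribˡ-+-* (b m) l (suc l)) ⟨
    b 0 ^ (suc d + d) * b m ^ (l + suc l)     ∎
    where
    open ≤-Reasoning
    m : ℕ
    m = suc l + d
    b : ℕ → ℕ
    b = evenCyc M
    lc : LogConvex b
    lc = evenCyc-logConvex sm

-- The threshold

-- An arbitrary vertex type and the admission of loops make this class closed under tensor powers,
-- including the empty one.
record Graph : Set₁ where
  field
    Vertex    : Set
    vertices  : List Vertex
    A         : Matrix Vertex
    symmetric : Symmetric A
    A≤1       : ∀ x y → A x y ≤ 1

  order : ℕ
  order = length vertices

  -- The number of homomorphisms from the cycle with i + 2 vertices.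
  cycles : ℕ → ℕ
  cycles = MatrixOver.cyc vertices A

-- A discrete intermediate value argument, searching downwards from `b`. It supplies the threshold.
last-satisfying : (g : ℕ → ℕ) (e : ℕ) → e ≤ g 0 → ∀ b → g b < e → ∃ λ s → e ≤ g s × g (suc s) < e
last-satisfying g e e≤ zero    g<e = contradiction e≤ (<⇒≱ g<e)
last-satisfying g e e≤ (suc b) g<e with e ≤? g b
... | yes e≤gb = b , e≤gb , g<e
... | no  e≰gb = last-satisfying g e e≤ b (≰⇒> e≰gb)

ifAbove ifBelow : ℕ → ℕ → ℕ → ℕ
ifAbove S v w with S ≤? v
... | yes _ = w
... | no  _ = 0
ifBelow S v w with S ≤? v
... | yes _ = 0
... | no  _ = w

ifAbove+ifBelow : ∀ S v w → w ≡ ifAbove S v w + ifBelow S v w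
ifAbove+ifBelow S v w with S ≤? v
... | yes _ = sym (+-identityʳ w)
... | no  _ = refl

S*ifAbove≤ : ∀ S v {w} → w ≤ 1 → S * ifAbove S v w ≤ v
S*ifAbove≤ S v w≤1 with S ≤? v
... | yes S≤v = ≤-trans (*-mono-≤ S≤v w≤1) (≤-reflexive (*-identityʳ v))
... | no  _   = subst (_≤ v) (sym (*-zeroʳ S)) z≤n

-- The negation of `suc S ≤ v` is `v ≤ S`. This is why `below` is taken at `suc S` where `above` is
-- taken at `S`.
ifBelow*≤ : ∀ S v w → ifBelow (suc S) v w * v ≤ S * w
ifBelow*≤ S v w with suc S ≤? v
... | yes _   = z≤n
... | no  S≰v = ≤-trans (≤-reflexive (*-comm w v)) (*-monoˡ-≤ w (≮⇒≥ S≰v))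

module Threshold (G : Graph) (l m : ℕ) where
  open Graph G renaming (vertices to xs)
  open MatrixOver xs

  private
    -- Here ℓ is `suc l` and k is `suc l + m`. Thus `cycles s` counts closed walks of length 2ℓ + 1,
    -- `pow A s` is A^(2ℓ), and `cycles (s + (m + m))` belongs to length 2k + 1.
    s : ℕ
    s = suc (l + l)

    q : Matrix Vertex
    q = pow A s

    E a : ℕ
    E = cycles s
    a = cycles (s + (m + m))

  above below : ℕ → Matrix Vertex
  above S x y = ifAbove S (q x y) (A x y)
  below S x y = ifBelow S (q x y) (A x y)

  above+below : ∀ S x y → A x y ≡ above S x y + below S x y
  above+below S x y = ifAbove+ifBelow S (q x y) (A x y)

  above≤A : ∀ S → above S ≤ₘ A
  above≤A S x y = subst (above S x y ≤_) (sym (above+below S x y)) (m≤m+n _ _)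

  below≤A : ∀ S → below S ≤ₘ A
  below≤A S x y = subst (below S x y ≤_) (sym (above+below S x y)) (m≤n+m _ _)

  above-symmetric : ∀ S → Symmetric (above S)
  above-symmetric S x y = cong₂ (ifAbove S) (pow-symmetric symmetric s x y) (symmetric x y)

  below-symmetric : ∀ S → Symmetric (below S)
  below-symmetric S x y = cong₂ (ifBelow S) (pow-symmetric symmetric s x y) (symmetric x y)

  above-lower : ∀ S x y → S * above S x y ≤ q x y
  above-lower S x y = S*ifAbove≤ S (q x y) (A≤1 x y)

  below-upper : ∀ S x y → below (suc S) x y * q x y ≤ S * A x y
  below-upper S x y = ifBelow*≤ S (q x y) (A x y)

  -- One edge of the closed walk absorbs `S` and becomes a walk of length 2ℓ, by S · `above S` ≤ q;
  -- the other edges are enlarged to A. The case i = 0 gives the bound by `E`, and i = 2m the bound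
  -- by `a`.
  S*cyc-above≤ : ∀ S i → S * cyc (above S) i ≤ cycles (s + i)
  S*cyc-above≤ S i = begin
    S * cyc (above S) i
      ≡⟨ trans (*-distribˡ-∑ xs S _) (∑-cong xs λ x → trans (*-distribˡ-∑ xs S _) (∑-cong xs λ y → sym (*-assoc S (above S x y) _))) ⟩
    ⟨ (λ x y → S * above S x y) , (pow (above S) i) ⟩
      ≤⟨ ⟨⟩-mono (above-lower S) (pow-mono (above≤A S) i) ⟩
    ⟨ q , (pow A i) ⟩ ≡⟨ ⟨pow,pow⟩ symmetric s i ⟩
    cycles (s + i)          ∎
    where open ≤-Reasoning

  cyc-above-0 : cyc (above 0) s ≡ E
  cyc-above-0 = ≤-antisym (⟨⟩-mono (above≤A 0) (pow-mono (above≤A 0) s))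
                          (⟨⟩-mono A≤above (pow-mono A≤above s))
    where
    A≤above : A ≤ₘ above 0
    -- The test `0 ≤? q x y` computes to `yes`, so `above 0 x y` reduces to `A x y`.
    A≤above x y = ≤-refl

  -- For S = E + 1 the bound S tr M² ≤ E leaves no edges, and the case m = 0 of `cyc-antitone`
  -- bounds the odd trace by a power of tr M² = 0.
  cyc-above-large : cyc (above (suc E)) s ≡ 0
  cyc-above-large = n≤0⇒n≡0 (^-cancelˡ-≤ 1 (subst (_≤ 0) (cong (c *_) (sym (*-identityʳ c))) (begin
    c * c                       ≡⟨ *-identityʳ (c * c) ⟨
    (c * c) ^ 1                 ≤⟨ cyc-antitone (above-symmetric (suc E)) {0} {l} z≤n ⟩
    evenCyc (above (suc E)) 0 ^ (suc l + suc (suc l)) ≡⟨ cong (_^ (suc l + suc (suc l))) noEdges ⟩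
    0                           ∎)))
    where
    open ≤-Reasoning
    c : ℕ
    c = cyc (above (suc E)) s
    noEdges : cyc (above (suc E)) 0 ≡ 0
    noEdges with cyc (above (suc E)) 0 in eq
    ... | zero  = refl
    ... | suc e = contradiction
      (≤-trans (m≤m*n (suc E) (suc e))
        (subst₂ (λ u v → suc E * u ≤ cycles v) eq (+-identityʳ s) (S*cyc-above≤ (suc E) 0)))
      (<⇒≱ ≤-refl)

  private
    n L : ℕ
    n = order
    L = suc (suc s)

  -- Sidorenko for the cycle of length 2m + 2, applied to the weighted matrix D. One edge is bounded
  -- by D ≤ q and the other 2m + 1 by D ≤ S A, which leaves closed walks of length 2ℓ + 2m + 1 = 2k
  -- + 1.
  below-bound : ∀ S → let X = ⟨ (below (suc S)) , q ⟩ in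
    (X * X) ^ suc m ≤ (n * n) ^ suc m * (S ^ suc (m + m) * a)
  below-bound S = begin
    (X * X) ^ suc m                            ≤⟨ total-evenCyc D-symmetric m ⟩
    (n * n) ^ suc m * cyc D (m + m)         ≤⟨ *-monoʳ-≤ ((n * n) ^ suc m) (⟨⟩-mono D≤q (pow-scale S (below-upper S) (m + m))) ⟩
    (n * n) ^ suc m * ⟨ q , (λ x y → S ^ suc (m + m) * pow A (m + m) x y) ⟩
      ≡⟨ cong ((n * n) ^ suc m *_) pullOut ⟩
    (n * n) ^ suc m * (S ^ suc (m + m) * a)    ∎
    where
    open ≤-Reasoning
    D : Matrix Vertex
    D x y = below (suc S) x y * q x y
    X : ℕ
    X = total D
    D-symmetric : Symmetric D
    D-symmetric x y = cong₂ _*_ (below-symmetric (suc S) x y) (pow-symmetric symmetric s x y)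
    D≤q : D ≤ₘ q
    D≤q x y = ≤-trans (*-monoˡ-≤ (q x y) (≤-trans (below≤A (suc S) x y) (A≤1 x y))) (≤-reflexive (*-identityˡ (q x y)))
    swap : ∀ a b c → a * (b * c) ≡ b * (a * c)
    swap = solve-∀
    pullOut : ⟨ q , (λ x y → S ^ suc (m + m) * pow A (m + m) x y) ⟩ ≡ S ^ suc (m + m) * a
    pullOut = begin-equality
      ⟨ q , (λ x y → S ^ suc (m + m) * pow A (m + m) x y) ⟩
        ≡⟨ ∑∑-cong (λ x y → swap (q x y) (S ^ suc (m + m)) (pow A (m + m) x y)) ⟩
      total (λ x y → S ^ suc (m + m) * (q x y * pow A (m + m) x y))
        ≡⟨ trans (*-distribˡ-∑ xs (S ^ suc (m + m)) _) (∑-cong xs λ x → *-distribˡ-∑ xs (S ^ suc (m + m)) _) ⟨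
      S ^ suc (m + m) * ⟨ q , (pow A (m + m)) ⟩
        ≡⟨ cong (S ^ suc (m + m) *_) (⟨pow,pow⟩ symmetric s (m + m)) ⟩
      S ^ suc (m + m) * a ∎

  record Balanced : Set where
    field
      S        : ℕ
      M        : Matrix Vertex
      M-sym    : Symmetric M
      half     : E ≤ 2 * cyc M s
      S*even≤a : S * evenCyc M m ≤ a
      S*edges≤E : S * evenCyc M 0 ≤ E
      E-upper  : (E * E) ^ suc m ≤ (2 * L * (2 * L)) ^ suc m * ((n * n) ^ suc m * a * S ^ suc (m + m))

  balanced : 0 < E → Balanced
  balanced 0<E = record
    { S = S ; M = above S ; M-sym = above-symmetric S ; half = half
    ; S*even≤a = S*cyc-above≤ S (m + m)
    ; S*edges≤E = subst (λ u → S * evenCyc (above S) 0 ≤ cycles u) (+-identityʳ s) (S*cyc-above≤ S 0)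
    ; E-upper = E-upper }
    where
    open ≤-Reasoning
    -- At threshold 0 every closed walk survives and at `suc E` none does. Between them lies an `S`
    -- that keeps at least half while `suc S` keeps less than half.
    choice : ∃ λ S → E ≤ 2 * cyc (above S) s × 2 * cyc (above (suc S)) s < E
    choice = last-satisfying (λ S → 2 * cyc (above S) s) E
      (subst (λ u → E ≤ 2 * u) (sym cyc-above-0) (m≤m+n E _))
      (suc E) (subst (λ u → 2 * u < E) (sym cyc-above-large) 0<E)
    S : ℕ
    S = proj₁ choice
    half : E ≤ 2 * cyc (above S) s
    half = proj₁ (proj₂ choice)
    X c : ℕ
    X = ⟨ (below (suc S)) , q ⟩
    c = cyc (above (suc S)) s
    -- More than half of the closed walks use an edge of `below (suc S)`. Each has `L` = 2ℓ + 1
    -- edges, hence the factor 2L.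
    E≤2LX : E ≤ 2 * L * X
    E≤2LX = +-cancelˡ-≤ E E (2 * L * X) (begin
      E + E                   ≡⟨ cong (E +_) (+-identityʳ E) ⟨
      2 * E                   ≤⟨ *-monoʳ-≤ 2 (cyc-telescope {A″ = below (suc S)} symmetric (above+below (suc S)) s) ⟩
      2 * (c + L * X)         ≡⟨ *-distribˡ-+ 2 c (L * X) ⟩
      2 * c + 2 * (L * X)     ≤⟨ +-monoˡ-≤ (2 * (L * X)) (<⇒≤ (proj₂ (proj₂ choice))) ⟩
      E + 2 * (L * X)         ≡⟨ cong (E +_) (*-assoc 2 L X) ⟨
      E + 2 * L * X           ∎)
    rearrange : ∀ a b c → a * (b * c) ≡ a * c * b
    rearrange = solve-∀
    E-upper : (E * E) ^ suc m ≤ (2 * L * (2 * L)) ^ suc m * ((n * n) ^ suc m * a * S ^ suc (m + m))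
    E-upper = begin
      (E * E) ^ suc m                              ≤⟨ ^-monoˡ-≤ (suc m) (*-mono-≤ E≤2LX E≤2LX) ⟩
      (2 * L * X * (2 * L * X)) ^ suc m            ≡⟨ cong (_^ suc m) ([m*n]*[o*p]≡[m*o]*[n*p] (2 * L) X (2 * L) X) ⟩
      (2 * L * (2 * L) * (X * X)) ^ suc m          ≡⟨ ^-distribʳ-* (2 * L * (2 * L)) (X * X) (suc m) ⟩
      (2 * L * (2 * L)) ^ suc m * (X * X) ^ suc m  ≤⟨ *-monoʳ-≤ ((2 * L * (2 * L)) ^ suc m) (below-bound S) ⟩
      (2 * L * (2 * L)) ^ suc m * ((n * n) ^ suc m * (S ^ suc (m + m) * a))
        ≡⟨ cong ((2 * L * (2 * L)) ^ suc m *_) (rearrange ((n * n) ^ suc m) (S ^ suc (m + m)) a) ⟩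
      (2 * L * (2 * L)) ^ suc m * ((n * n) ^ suc m * a * S ^ suc (m + m)) ∎

-- Elimination of the threshold and of the constant

[x*x]^n : ∀ x n → (x * x) ^ n ≡ x ^ (n + n)
[x*x]^n x n = trans (^-distribʳ-* x x n) (sym (^-distribˡ-+-* x n n))

-- The powers `L` and `R` of the two inequalities both contain z^(RL). Substituting one into the
-- other removes z without dividing by it.
eliminate : ∀ x y z u v K₁ K₂ R L →
  x ≤ K₁ * (y * z ^ R) → z ^ L * u ≤ K₂ * v → x ^ L * u ^ R ≤ K₁ ^ L * K₂ ^ R * (y ^ L * v ^ R)
eliminate x y z u v K₁ K₂ R L x≤ zu≤ = begin
  x ^ L * u ^ R                             ≤⟨ *-monoˡ-≤ (u ^ R) (^-monoˡ-≤ L x≤) ⟩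
  (K₁ * (y * z ^ R)) ^ L * u ^ R            ≡⟨ cong (_* u ^ R) (^-distribʳ-* K₁ (y * z ^ R) L) ⟩
  K₁ ^ L * (y * z ^ R) ^ L * u ^ R          ≡⟨ cong (λ t → K₁ ^ L * t * u ^ R) (^-distribʳ-* y (z ^ R) L) ⟩
  K₁ ^ L * (y ^ L * (z ^ R) ^ L) * u ^ R    ≡⟨ cong (λ t → K₁ ^ L * (y ^ L * t) * u ^ R) (^-swap z R L) ⟩
  K₁ ^ L * (y ^ L * (z ^ L) ^ R) * u ^ R    ≡⟨ regroup (K₁ ^ L) (y ^ L) ((z ^ L) ^ R) (u ^ R) ⟩
  K₁ ^ L * y ^ L * ((z ^ L) ^ R * u ^ R)    ≡⟨ cong (K₁ ^ L * y ^ L *_) (^-distribʳ-* (z ^ L) u R) ⟨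
  K₁ ^ L * y ^ L * (z ^ L * u) ^ R          ≤⟨ *-monoʳ-≤ (K₁ ^ L * y ^ L) (^-monoˡ-≤ R zu≤) ⟩
  K₁ ^ L * y ^ L * (K₂ * v) ^ R             ≡⟨ cong (K₁ ^ L * y ^ L *_) (^-distribʳ-* K₂ v R) ⟩
  K₁ ^ L * y ^ L * (K₂ ^ R * v ^ R)         ≡⟨ [m*n]*[o*p]≡[m*o]*[n*p] (K₁ ^ L) (y ^ L) (K₂ ^ R) (v ^ R) ⟩
  K₁ ^ L * K₂ ^ R * (y ^ L * v ^ R)         ∎
  where
  open ≤-Reasoning
  regroup : ∀ a b c d → a * (b * c) * d ≡ a * b * (c * d)
  regroup = solve-∀

eliminate₁ : ∀ {E a n S K₁ K₂} m L →
  (E * E) ^ suc m ≤ K₁ * ((n * n) ^ suc m * a * S ^ suc (m + m)) →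
  S ^ L * (E * E) ^ suc m ≤ K₂ * a ^ L →
  E ^ (L + suc (m + m)) ≤ K₁ ^ L * K₂ ^ suc (m + m) * (n ^ L * a ^ L)
-- With R + 1 = 2N, the exponents of E, n and a after elimination are all multiples of N + N, so a
-- root of that order is taken.
eliminate₁ {E} {a} {n} {S} {K₁} {K₂} m L upper lower = ^-cancelˡ-≤ (m + N) (begin
  (E ^ (L + R)) ^ (N + N)                        ≡⟨ ^-swap E (L + R) (N + N) ⟩
  (E ^ (N + N)) ^ (L + R)                        ≡⟨ cong (_^ (L + R)) ([x*x]^n E N) ⟨
  ((E * E) ^ N) ^ (L + R)                        ≡⟨ ^-distribˡ-+-* ((E * E) ^ N) L R ⟩
  ((E * E) ^ N) ^ L * ((E * E) ^ N) ^ R          ≤⟨ eliminate ((E * E) ^ N) ((n * n) ^ N * a) S ((E * E) ^ N) (a ^ L) K₁ K₂ R L upper lower ⟩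
  K * (((n * n) ^ N * a) ^ L * (a ^ L) ^ R)      ≡⟨ cong (λ u → K * (u * (a ^ L) ^ R)) (^-distribʳ-* ((n * n) ^ N) a L) ⟩
  K * (((n * n) ^ N) ^ L * a ^ L * (a ^ L) ^ R)  ≡⟨ cong (K *_) (*-assoc (((n * n) ^ N) ^ L) (a ^ L) ((a ^ L) ^ R)) ⟩
  K * (((n * n) ^ N) ^ L * (a ^ L) ^ suc R)
    ≡⟨ cong₂ (λ u v → K * (u * (a ^ L) ^ v)) (trans (cong (_^ L) ([x*x]^n n N)) (^-swap n (N + N) L)) (cong suc (sym (+-suc m m))) ⟩
  K * ((n ^ L) ^ (N + N) * (a ^ L) ^ (N + N))    ≡⟨ cong (K *_) (^-distribʳ-* (n ^ L) (a ^ L) (N + N)) ⟨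
  -- The constant is weakened to `K ^ (N + N)` to make the right side a perfect power; its size is
  -- irrelevant for the tensor trick.
  K * (n ^ L * a ^ L) ^ (N + N)                  ≤⟨ *-monoˡ-≤ _ (x≤x^[1+n] K (m + N)) ⟩
  K ^ (N + N) * (n ^ L * a ^ L) ^ (N + N)        ≡⟨ ^-distribʳ-* K (n ^ L * a ^ L) (N + N) ⟨
  (K * (n ^ L * a ^ L)) ^ (N + N)                ∎)
  where
  open ≤-Reasoning
  N R K : ℕ
  N = suc m
  R = suc (m + m)
  K = K₁ ^ L * K₂ ^ R

eliminate₂ : ∀ {E a n S K₁ K₂} m v →
  (E * E) ^ suc m ≤ K₁ * ((n * n) ^ suc m * a * S ^ suc (m + m)) →
  S ^ (m + m) * E ^ v ≤ K₂ * a ^ v →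
  E ^ ((suc m + suc m) * (m + m) + v * suc (m + m)) ≤
  K₁ ^ (m + m) * K₂ ^ suc (m + m) * (n ^ ((suc m + suc m) * (m + m)) * a ^ (m + m + v * suc (m + m)))
eliminate₂ {E} {a} {n} {S} {K₁} {K₂} m v upper lower = begin
  E ^ ((N + N) * M + v * R)                      ≡⟨ ^-distribˡ-+-* E ((N + N) * M) (v * R) ⟩
  E ^ ((N + N) * M) * E ^ (v * R)                ≡⟨ cong₂ _*_ (power E) (^-*-assoc E v R) ⟨
  ((E * E) ^ N) ^ M * (E ^ v) ^ R                ≤⟨ eliminate ((E * E) ^ N) ((n * n) ^ N * a) S (E ^ v) (a ^ v) K₁ K₂ R M upper lower ⟩
  K * (((n * n) ^ N * a) ^ M * (a ^ v) ^ R)      ≡⟨ cong (λ u → K * (u * (a ^ v) ^ R)) (^-distribʳ-* ((n * n) ^ N) a M) ⟩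
  K * (((n * n) ^ N) ^ M * a ^ M * (a ^ v) ^ R)  ≡⟨ cong (K *_) (*-assoc (((n * n) ^ N) ^ M) (a ^ M) ((a ^ v) ^ R)) ⟩
  K * (((n * n) ^ N) ^ M * (a ^ M * (a ^ v) ^ R))
    ≡⟨ cong₂ (λ t u → K * (t * u)) (power n) (trans (cong (a ^ M *_) (^-*-assoc a v R)) (sym (^-distribˡ-+-* a M (v * R)))) ⟩
  K * (n ^ ((N + N) * M) * a ^ (M + v * R))      ∎
  where
  open ≤-Reasoning
  N R M K : ℕ
  N = suc m
  R = suc (m + m)
  M = m + m
  K = K₁ ^ M * K₂ ^ R
  power : ∀ x → ((x * x) ^ N) ^ M ≡ x ^ ((N + N) * M)
  power x = trans (cong (_^ M) ([x*x]^n x N)) (^-*-assoc x (N + N) M)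

-- Bounds up to a constant

open Graph using (cycles; order)

roughBound₁ : ∀ l m → m ≤ l → let L = suc l + suc (suc l) in
  ∃ λ K → ∀ G → cycles G (suc (l + l)) ^ (L + suc (m + m)) ≤
                K * (order G ^ L * cycles G (suc (l + l) + (m + m)) ^ L)
roughBound₁ l m m≤l = K₁ ^ L * (4 ^ suc m) ^ suc (m + m) , bound
  where
  L K₁ : ℕ
  L = suc l + suc (suc l)
  K₁ = (2 * (3 + (l + l)) * (2 * (3 + (l + l)))) ^ suc m
  bound : ∀ G → cycles G (suc (l + l)) ^ (L + suc (m + m)) ≤
    K₁ ^ L * (4 ^ suc m) ^ suc (m + m) * (order G ^ L * cycles G (suc (l + l) + (m + m)) ^ L)
  bound G with cycles G (suc (l + l)) in eq
  -- A threshold is chosen only when closed walks exist; otherwise the left side is 0.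
  ... | zero = z≤n
  ... | suc e = eliminate₁ {a = a} {n = order G} {S = S} {K₁ = K₁} {K₂ = 4 ^ suc m} m L
    (subst (λ u → (u * u) ^ suc m ≤ K₁ * ((order G * order G) ^ suc m * a * S ^ suc (m + m))) eq E-upper)
    (subst (λ u → S ^ L * (u * u) ^ suc m ≤ 4 ^ suc m * a ^ L) eq lower)
    where
    open Threshold G l m
    open MatrixOver (Graph.vertices G)
    open Balanced (balanced (subst (0 <_) (sym eq) (s≤s z≤n)))
    a E E′ : ℕ
    a = cycles G (suc (l + l) + (m + m))
    E = cycles G (suc (l + l))
    E′ = cyc M (suc (l + l))
    open ≤-Reasoning
    lower : S ^ L * (E * E) ^ suc m ≤ 4 ^ suc m * a ^ L
    lower = begin
      -- Half of the closed walks lie in M, so E ≤ 2E′; squaring produces the 4. Each factor tr M^r,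
      -- with r = 2m + 2, then meets one factor S.
      S ^ L * (E * E) ^ suc m                     ≤⟨ *-monoʳ-≤ (S ^ L) (^-monoˡ-≤ (suc m) (*-mono-≤ half half)) ⟩
      S ^ L * (2 * E′ * (2 * E′)) ^ suc m         ≡⟨ cong (λ u → S ^ L * u ^ suc m) ([m*n]*[o*p]≡[m*o]*[n*p] 2 E′ 2 E′) ⟩
      S ^ L * (4 * (E′ * E′)) ^ suc m             ≡⟨ cong (S ^ L *_) (^-distribʳ-* 4 (E′ * E′) (suc m)) ⟩
      S ^ L * (4 ^ suc m * (E′ * E′) ^ suc m)     ≤⟨ *-monoʳ-≤ (S ^ L) (*-monoʳ-≤ (4 ^ suc m) (cyc-antitone M-sym m≤l)) ⟩
      S ^ L * (4 ^ suc m * evenCyc M m ^ L)       ≡⟨ swap (S ^ L) (4 ^ suc m) (evenCyc M m ^ L) ⟩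
      4 ^ suc m * (S ^ L * evenCyc M m ^ L)       ≡⟨ cong (4 ^ suc m *_) (^-distribʳ-* S (evenCyc M m) L) ⟨
      4 ^ suc m * (S * evenCyc M m) ^ L           ≤⟨ *-monoʳ-≤ (4 ^ suc m) (^-monoˡ-≤ L S*even≤a) ⟩
      4 ^ suc m * a ^ L                           ∎
      where
      swap : ∀ x y z → x * (y * z) ≡ y * (x * z)
      swap = solve-∀

roughBound₂ : ∀ l d → let m = suc l + d ; v = l + suc l in
  ∃ λ K → ∀ G → cycles G (suc (l + l)) ^ ((suc m + suc m) * (m + m) + v * suc (m + m)) ≤
                K * (order G ^ ((suc m + suc m) * (m + m)) *
                     cycles G (suc (l + l) + (m + m)) ^ (m + m + v * suc (m + m)))
roughBound₂ l d = K₁ ^ (m + m) * (4 ^ m) ^ suc (m + m) , bound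
  where
  m u v K₁ : ℕ
  m = suc l + d
  u = suc d + d
  v = l + suc l
  K₁ = (2 * (3 + (l + l)) * (2 * (3 + (l + l)))) ^ suc m
  u+v≡m+m : ∀ l d → suc d + d + (l + suc l) ≡ suc l + d + (suc l + d)
  u+v≡m+m = solve-∀
  bound : ∀ G → cycles G (suc (l + l)) ^ ((suc m + suc m) * (m + m) + v * suc (m + m)) ≤
    K₁ ^ (m + m) * (4 ^ m) ^ suc (m + m) * (order G ^ ((suc m + suc m) * (m + m)) * cycles G (suc (l + l) + (m + m)) ^ (m + m + v * suc (m + m)))
  bound G with cycles G (suc (l + l)) in eq
  ... | zero = z≤n
  ... | suc e = eliminate₂ {a = a} {n = order G} {S = S} {K₁ = K₁} {K₂ = 4 ^ m} m v
    (subst (λ w → (w * w) ^ suc m ≤ K₁ * ((order G * order G) ^ suc m * a * S ^ suc (m + m))) eq E-upper)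
    (subst (λ w → S ^ (m + m) * w ^ v ≤ 4 ^ m * a ^ v) eq lower)
    where
    open Threshold G l m
    open MatrixOver (Graph.vertices G)
    a E E′ : ℕ
    a = cycles G (suc (l + l) + (m + m))
    E = cycles G (suc (l + l))
    0<E : 0 < E
    0<E = subst (0 <_) (sym eq) (s≤s z≤n)
    open Balanced (balanced 0<E)
    E′ = cyc M (suc (l + l))
    open ≤-Reasoning
    swap : ∀ x y z w t → x * y * (z * (w * t)) ≡ z * (x * w * (y * t))
    swap = solve-∀
    lower : S ^ (m + m) * E ^ v ≤ 4 ^ m * a ^ v
    -- The extra factor E^u completes the exponent u + v = 2m of the interpolation. Then S^u is
    -- spent on S tr M² ≤ E and S^v on S tr M^r ≤ a, and the resulting E^u is cancelled, as E > 0.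
    lower = *-cancelʳ-≤ _ _ (E ^ u) {{m^n≢0 E u {{>-nonZero 0<E}}}} (begin
      S ^ (m + m) * E ^ v * E ^ u                 ≡⟨ *-assoc (S ^ (m + m)) (E ^ v) (E ^ u) ⟩
      S ^ (m + m) * (E ^ v * E ^ u)               ≡⟨ cong₂ (λ w t → S ^ w * t) (sym (u+v≡m+m l d)) (trans (sym (^-distribˡ-+-* E v u)) (cong (E ^_) (trans (+-comm v u) (u+v≡m+m l d)))) ⟩
      S ^ (u + v) * E ^ (m + m)                   ≡⟨ cong₂ _*_ (^-distribˡ-+-* S u v) (sym ([x*x]^n E m)) ⟩
      S ^ u * S ^ v * (E * E) ^ m                 ≤⟨ *-monoʳ-≤ (S ^ u * S ^ v) (^-monoˡ-≤ m (*-mono-≤ half half)) ⟩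
      S ^ u * S ^ v * (2 * E′ * (2 * E′)) ^ m     ≡⟨ cong (λ w → S ^ u * S ^ v * w ^ m) ([m*n]*[o*p]≡[m*o]*[n*p] 2 E′ 2 E′) ⟩
      S ^ u * S ^ v * (4 * (E′ * E′)) ^ m         ≡⟨ cong (S ^ u * S ^ v *_) (^-distribʳ-* 4 (E′ * E′) m) ⟩
      S ^ u * S ^ v * (4 ^ m * (E′ * E′) ^ m)     ≤⟨ *-monoʳ-≤ (S ^ u * S ^ v) (*-monoʳ-≤ (4 ^ m) (cyc-interpolate M-sym l d)) ⟩
      S ^ u * S ^ v * (4 ^ m * (evenCyc M 0 ^ u * evenCyc M m ^ v)) ≡⟨ swap (S ^ u) (S ^ v) (4 ^ m) (evenCyc M 0 ^ u) (evenCyc M m ^ v) ⟩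
      4 ^ m * (S ^ u * evenCyc M 0 ^ u * (S ^ v * evenCyc M m ^ v)) ≡⟨ cong (4 ^ m *_) (cong₂ _*_ (^-distribʳ-* S (evenCyc M 0) u) (^-distribʳ-* S (evenCyc M m) v)) ⟨
      4 ^ m * ((S * evenCyc M 0) ^ u * (S * evenCyc M m) ^ v) ≤⟨ *-monoʳ-≤ (4 ^ m) (*-mono-≤ (^-monoˡ-≤ u S*edges≤E) (^-monoˡ-≤ v S*even≤a)) ⟩
      4 ^ m * (E ^ u * a ^ v)                     ≡⟨ cong (4 ^ m *_) (*-comm (E ^ u) (a ^ v)) ⟩
      4 ^ m * (a ^ v * E ^ u)                     ≡⟨ *-assoc (4 ^ m) (a ^ v) (E ^ u) ⟨
      4 ^ m * a ^ v * E ^ u                       ∎)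

-- Tensor powers of graphs

_⊗_ : Graph → Graph → Graph
G ⊗ H = record
  { Vertex    = G.Vertex × H.Vertex
  ; vertices  = cartesianProduct G.vertices H.vertices
  ; A         = λ (x , x′) (y , y′) → G.A x y * H.A x′ y′
  ; symmetric = λ (x , x′) (y , y′) → cong₂ _*_ (G.symmetric x y) (H.symmetric x′ y′)
  ; A≤1       = λ (x , x′) (y , y′) → *-mono-≤ (G.A≤1 x y) (H.A≤1 x′ y′)
  }
  where
  module G = Graph G
  module H = Graph H

∑-⊗ : ∀ {I J : Set} (xs : List I) (ys : List J) (f : I → ℕ) (g : J → ℕ) →
  ∑ (cartesianProduct xs ys) (λ (x , y) → f x * g y) ≡ ∑ xs f * ∑ ys g
∑-⊗ xs ys f g = trans (∑-cartesianProduct xs ys _) (sym (∑*∑ xs ys f g))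

module _ (G H : Graph) where
  private
    module G = Graph G
    module H = Graph H
    module G⊗H = Graph (G ⊗ H)
    module MG = MatrixOver G.vertices
    module MH = MatrixOver H.vertices
    module M⊗ = MatrixOver G⊗H.vertices

  pow-⊗ : ∀ i x x′ y y′ → M⊗.pow G⊗H.A i (x , x′) (y , y′) ≡ MG.pow G.A i x y * MH.pow H.A i x′ y′
  pow-⊗ zero    x x′ y y′ = refl
  pow-⊗ (suc i) x x′ y y′ = trans
    (∑-cong G⊗H.vertices λ (z , z′) → trans
      (cong (G.A x z * H.A x′ z′ *_) (pow-⊗ i z z′ y y′))
      ([m*n]*[o*p]≡[m*o]*[n*p] (G.A x z) (H.A x′ z′) (MG.pow G.A i z y) (MH.pow H.A i z′ y′)))
    (∑-⊗ G.vertices H.vertices _ _)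

  cycles-⊗ : ∀ i → cycles (G ⊗ H) i ≡ cycles G i * cycles H i
  cycles-⊗ i = trans
    (∑-cong G⊗H.vertices λ (x , x′) → trans
      (∑-cong G⊗H.vertices λ (y , y′) → trans
        (cong (G.A x y * H.A x′ y′ *_) (pow-⊗ i x x′ y y′))
        ([m*n]*[o*p]≡[m*o]*[n*p] (G.A x y) (H.A x′ y′) (MG.pow G.A i x y) (MH.pow H.A i x′ y′)))
      (∑-⊗ G.vertices H.vertices _ _))
    (∑-⊗ G.vertices H.vertices _ _)

  order-⊗ : order (G ⊗ H) ≡ order G * order H
  order-⊗ = begin
    order (G ⊗ H)                                ≡⟨ ∑-one G⊗H.vertices ⟨
    ∑ G⊗H.vertices (λ _ → 1)                     ≡⟨ ∑-⊗ G.vertices H.vertices (λ _ → 1) (λ _ → 1) ⟩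
    ∑ G.vertices (λ _ → 1) * ∑ H.vertices (λ _ → 1) ≡⟨ cong₂ _*_ (∑-one G.vertices) (∑-one H.vertices) ⟩
    order G * order H                            ∎
    where open ≡-Reasoning

-- The unit of the tensor product, serving as the zeroth tensor power.
loop : Graph
loop = record
  { Vertex = ⊤ ; vertices = tt ∷ [] ; A = λ _ _ → 1 ; symmetric = λ _ _ → refl ; A≤1 = λ _ _ → s≤s z≤n }

cycles-loop : ∀ i → cycles loop i ≡ 1
cycles-loop i = cong (λ u → u + 0 + 0 + 0) (pow-loop i)
  where
  pow-loop : ∀ i → MatrixOver.pow (tt ∷ []) (λ _ _ → 1) i tt tt ≡ 1
  pow-loop zero    = refl
  pow-loop (suc i) = cong (λ u → u + 0 + 0) (pow-loop i)

_^⊗_ : Graph → ℕ → Graph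
G ^⊗ zero  = loop
G ^⊗ suc N = G ⊗ (G ^⊗ N)

cycles-^⊗ : ∀ G N i → cycles (G ^⊗ N) i ≡ cycles G i ^ N
cycles-^⊗ G zero    i = cycles-loop i
cycles-^⊗ G (suc N) i = trans (cycles-⊗ G (G ^⊗ N) i) (cong (cycles G i *_) (cycles-^⊗ G N i))

order-^⊗ : ∀ G N → order (G ^⊗ N) ≡ order G ^ N
order-^⊗ G zero    = refl
order-^⊗ G (suc N) = trans (order-⊗ G (G ^⊗ N)) (cong (order G *_) (order-^⊗ G N))

-- Order and cycle counts are multiplicative under tensor products, and `K` is the same for all
-- graphs. Hence the N-th powers of both sides satisfy the bound with one fixed `K` for every N.
tensorTrick : ∀ i j p s t →
  (∃ λ K → ∀ G → cycles G i ^ p ≤ K * (order G ^ s * cycles G j ^ t)) →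
  ∀ G → cycles G i ^ p ≤ order G ^ s * cycles G j ^ t
tensorTrick i j p s t (K , bound) G = powers-bounded⇒≤ K λ N → begin
  (cycles G i ^ p) ^ N                              ≡⟨ ^-swap (cycles G i) p N ⟩
  (cycles G i ^ N) ^ p                              ≡⟨ cong (_^ p) (cycles-^⊗ G N i) ⟨
  cycles (G ^⊗ N) i ^ p                             ≤⟨ bound (G ^⊗ N) ⟩
  K * (order (G ^⊗ N) ^ s * cycles (G ^⊗ N) j ^ t)  ≡⟨ cong₂ (λ u v → K * (u ^ s * v ^ t)) (order-^⊗ G N) (cycles-^⊗ G N j) ⟩
  K * ((order G ^ N) ^ s * (cycles G j ^ N) ^ t)    ≡⟨ cong₂ (λ u v → K * (u * v)) (^-swap (order G) N s) (^-swap (cycles G j) N t) ⟩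
  K * ((order G ^ s) ^ N * (cycles G j ^ t) ^ N)    ≡⟨ cong (K *_) (^-distribʳ-* (order G ^ s) (cycles G j ^ t) N) ⟨
  K * (order G ^ s * cycles G j ^ t) ^ N            ∎
  where open ≤-Reasoning

-- Homomorphisms from cycles as closed walks

𝟙 : Bool → ℕ
𝟙 b = if b then 1 else 0

𝟙-∧ : ∀ b c → 𝟙 (b ∧ c) ≡ 𝟙 b * 𝟙 c
𝟙-∧ true  c = sym (+-identityʳ (𝟙 c))
𝟙-∧ false c = refl

𝟙≤1 : ∀ b → 𝟙 b ≤ 1
𝟙≤1 true  = ≤-refl
𝟙≤1 false = z≤n

toGraph : (T : RawGraph) → IsSimple T → Graph
toGraph T simple = record
  { Vertex = Fin (V T) ; vertices = allFin (V T) ; A = λ x y → 𝟙 (adj T x y)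
  ; symmetric = λ x y → cong 𝟙 (IsSimple.symm simple x y) ; A≤1 = λ x y → 𝟙≤1 (adj T x y) }

⇔⇒≡ : ∀ {b c} → (b ≡ true → c ≡ true) → (c ≡ true → b ≡ true) → b ≡ c
⇔⇒≡ {true}  {c}     f g = sym (f refl)
⇔⇒≡ {false} {true}  f g = g refl
⇔⇒≡ {false} {false} f g = refl

∧-true⁻ : ∀ {b c} → b ∧ c ≡ true → b ≡ true × c ≡ true
∧-true⁻ {true} eq = refl , eq

∧-true⁺ : ∀ {b c} → b ≡ true → c ≡ true → b ∧ c ≡ true
∧-true⁺ refl eq = eq

∨-true⁻ : ∀ {b c} → b ∨ c ≡ true → b ≡ true ⊎ c ≡ true
∨-true⁻ {true}  eq = inj₁ refl
∨-true⁻ {false} eq = inj₂ eq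

≡ᵇ-true⁻ : ∀ m n → (m ≡ᵇ n) ≡ true → m ≡ n
≡ᵇ-true⁻ m n eq = ≡ᵇ⇒≡ m n (subst T (sym eq) _)

≡ᵇ-refl : ∀ n → (n ≡ᵇ n) ≡ true
≡ᵇ-refl zero    = refl
≡ᵇ-refl (suc n) = ≡ᵇ-refl n

and-map⁻ : ∀ {I : Set} (p : I → Bool) {xs x} → and (map p xs) ≡ true → x ∈ xs → p x ≡ true
and-map⁻ p {x ∷ xs} eq (here refl) = proj₁ (∧-true⁻ eq)
and-map⁻ p {x ∷ xs} eq (there x∈)  = and-map⁻ p (proj₂ (∧-true⁻ {p x} eq)) x∈

and-map⁺ : ∀ {I : Set} (p : I → Bool) xs → (∀ x → p x ≡ true) → and (map p xs) ≡ true
and-map⁺ p []       all = refl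
and-map⁺ p (x ∷ xs) all = ∧-true⁺ (all x) (and-map⁺ p xs all)

isHom⁻ : ∀ H T f → isHom H T f ≡ true → ∀ u v → adj H u v ≡ true → adj T (f u) (f v) ≡ true
isHom⁻ H T f eq u v uv = subst (λ b → not b ∨ adj T (f u) (f v) ≡ true) uv
  (and-map⁻ _ (and-map⁻ _ eq (∈-allFin u)) (∈-allFin v))

isHom⁺ : ∀ H T f → (∀ u v → adj H u v ≡ true → adj T (f u) (f v) ≡ true) → isHom H T f ≡ true
isHom⁺ H T f edges = and-map⁺ _ (allFin (V H)) λ u → and-map⁺ _ (allFin (V H)) λ v → implication u v
  where
  implication : ∀ u v → not (adj H u v) ∨ adj T (f u) (f v) ≡ true
  implication u v with adj H u v in eq
  ... | true  = edges u v eq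
  ... | false = refl

succMod-last : ∀ m → succMod (suc m) m ≡ 0
succMod-last m rewrite ≡ᵇ-refl m = refl

succMod-step : ∀ {m i} → i < m → succMod (suc m) i ≡ suc i
succMod-step {m} {i} i<m with i ≡ᵇ m in eq
... | true  = contradiction (≡ᵇ-true⁻ i m eq) (<⇒≢ i<m)
... | false = refl

succMod⁻ : ∀ m i {j} → j ≡ succMod (suc m) i → i ≡ m × j ≡ 0 ⊎ j ≡ suc i
succMod⁻ m i j≡ with i ≡ᵇ m in eq
... | true  = inj₁ (≡ᵇ-true⁻ i m eq , j≡)
... | false = inj₂ j≡

module _ (T : RawGraph) (simple : IsSimple T) where
  open IsSimple simple

  isWalk : ∀ m → (Fin (suc m) → Fin (V T)) → Bool
  isWalk zero    f = true
  isWalk (suc m) f = adj T (f fzero) (f (fsuc fzero)) ∧ isWalk m (f ∘ fsuc)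

  isClosedWalk : ∀ m → (Fin (suc m) → Fin (V T)) → Bool
  isClosedWalk m f = isWalk m f ∧ adj T (f fzero) (f (fromℕ m))

  isWalk⁻ : ∀ m f → isWalk m f ≡ true → ∀ j → adj T (f (inject₁ j)) (f (fsuc j)) ≡ true
  isWalk⁻ (suc m) f eq fzero    = proj₁ (∧-true⁻ eq)
  isWalk⁻ (suc m) f eq (fsuc j) = isWalk⁻ m (f ∘ fsuc) (proj₂ (∧-true⁻ {adj T (f fzero) (f (fsuc fzero))} eq)) j

  isWalk⁺ : ∀ m f → (∀ j → adj T (f (inject₁ j)) (f (fsuc j)) ≡ true) → isWalk m f ≡ true
  isWalk⁺ zero    f edges = refl
  isWalk⁺ (suc m) f edges = ∧-true⁺ (edges fzero) (isWalk⁺ m (f ∘ fsuc) (edges ∘ fsuc))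

  -- The edges of the cycle are the consecutive pairs and the wrap-around pair. Symmetry of T takes
  -- care of the two orientations.
  isHom-Cycle : ∀ m f → isHom (Cycle (suc m)) T f ≡ isClosedWalk m f
  isHom-Cycle m f = ⇔⇒≡ to from
    where
    to : isHom (Cycle (suc m)) T f ≡ true → isClosedWalk m f ≡ true
    to eq = ∧-true⁺ (isWalk⁺ m f λ j → edges (inject₁ j) (fsuc j) (step j))
                    (edges fzero (fromℕ m) closing)
      where
      edges : ∀ u v → adj (Cycle (suc m)) u v ≡ true → adj T (f u) (f v) ≡ true
      edges = isHom⁻ (Cycle (suc m)) T f eq
      step : ∀ j → adj (Cycle (suc m)) (inject₁ j) (fsuc j) ≡ true
      step j rewrite toℕ-inject₁ j | succMod-step (toℕ<n j) | ≡ᵇ-refl (toℕ j) = refl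
      closing : adj (Cycle (suc m)) fzero (fromℕ m) ≡ true
      closing rewrite toℕ-fromℕ m | succMod-last m = ∨-zeroʳ (m ≡ᵇ succMod (suc m) 0)
    from : isClosedWalk m f ≡ true → isHom (Cycle (suc m)) T f ≡ true
    from eq = isHom⁺ (Cycle (suc m)) T f edges
      where
      successor : ∀ u v → toℕ v ≡ succMod (suc m) (toℕ u) → adj T (f u) (f v) ≡ true
      successor u v v≡ with succMod⁻ m (toℕ u) v≡
      successor u fzero v≡ | inj₁ (u≡m , _)
        rewrite toℕ-injective {i = u} {fromℕ m} (trans u≡m (sym (toℕ-fromℕ m))) =
        trans (symm (f (fromℕ m)) (f fzero)) (proj₂ (∧-true⁻ {isWalk m f} eq))
      successor u (fsuc j) v≡ | inj₂ v≡1+u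
        rewrite toℕ-injective {i = u} {inject₁ j} (trans (sym (cong (_∸ 1) v≡1+u)) (sym (toℕ-inject₁ j))) =
        isWalk⁻ m f (proj₁ (∧-true⁻ {isWalk m f} eq)) j
      edges : ∀ u v → adj (Cycle (suc m)) u v ≡ true → adj T (f u) (f v) ≡ true
      edges u v uv with ∨-true⁻ {toℕ v ≡ᵇ succMod (suc m) (toℕ u)} uv
      ... | inj₁ v≡ = successor u v (≡ᵇ-true⁻ (toℕ v) _ v≡)
      ... | inj₂ u≡ = trans (symm (f u) (f v)) (successor v u (≡ᵇ-true⁻ (toℕ u) _ u≡))

  private
    n : ℕ
    n = V T
    G : Graph
    G = toGraph T simple
    open Graph G using (A; symmetric; vertices)
    open MatrixOver vertices

  -- allMaps extends maps by an anonymous function, which is therefore only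
  -- described here up to pointwise equality.
  ∑-allMaps : ∀ m (F : (Fin (suc m) → Fin n) → ℕ) (F′ : (Fin m → Fin n) → Fin n → ℕ) →
    (∀ g f x → g fzero ≡ x → (∀ i → g (fsuc i) ≡ f i) → F g ≡ F′ f x) →
    ∑ (allMaps (suc m) n) F ≡ ∑ (allMaps m n) λ f → ∑ (allFin n) λ x → F′ f x
  ∑-allMaps m F F′ F≡F′ = trans (∑-concatMap _ (allMaps m n) F)
    (∑-cong (allMaps m n) λ f → trans (∑-map (allFin n) _ F) (∑-cong (allFin n) λ x → F≡F′ _ f x refl λ i → refl))

  isWalk-cong : ∀ m {g f} → (∀ i → g i ≡ f i) → isWalk m g ≡ isWalk m f
  isWalk-cong zero    g≡f = refl
  isWalk-cong (suc m) g≡f = cong₂ _∧_ (cong₂ (adj T) (g≡f fzero) (g≡f (fsuc fzero))) (isWalk-cong m (g≡f ∘ fsuc))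

  -- A general weight ψ on the two ends, in place of the closing edge, gives an induction on the
  -- length.
  walks : ∀ m (ψ : Fin n → Fin n → ℕ) → ℕ
  walks m ψ = ∑ (allMaps (suc m) n) λ f → 𝟙 (isWalk m f) * ψ (f fzero) (f (fromℕ m))

  walks-zero : ∀ ψ → walks 0 ψ ≡ ∑ vertices λ x → ψ x x
  walks-zero ψ = trans
    (∑-allMaps 0 _ (λ _ x → ψ x x) λ g f x g0≡x _ → trans (+-identityʳ _) (cong₂ ψ g0≡x g0≡x))
    (+-identityʳ _)

  -- Summing over the first vertex of the walk absorbs its first edge into the weight.
  walks-suc : ∀ m ψ → walks (suc m) ψ ≡ walks m (A ⊡ ψ)
  walks-suc m ψ = trans
    (∑-allMaps (suc m) _ (λ f x → 𝟙 (isWalk m f) * (A (f fzero) x * ψ x (f (fromℕ m)))) split)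
    (∑-cong (allMaps (suc m) n) λ f → sym (*-distribˡ-∑ vertices (𝟙 (isWalk m f)) _))
    where
    split : ∀ g f x → g fzero ≡ x → (∀ i → g (fsuc i) ≡ f i) →
      𝟙 (isWalk (suc m) g) * ψ (g fzero) (g (fromℕ (suc m))) ≡
      𝟙 (isWalk m f) * (A (f fzero) x * ψ x (f (fromℕ m)))
    split g f x g0≡x g≡f = begin
      𝟙 (isWalk (suc m) g) * ψ (g fzero) (g (fromℕ (suc m)))
        ≡⟨ cong₂ (λ b c → 𝟙 b * c)
             (cong₂ _∧_ (cong₂ (adj T) g0≡x (g≡f fzero)) (isWalk-cong m g≡f))
             (cong₂ ψ g0≡x (g≡f (fromℕ m))) ⟩
      𝟙 (adj T x (f fzero) ∧ isWalk m f) * ψ x (f (fromℕ m))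
        ≡⟨ cong (_* ψ x (f (fromℕ m))) (trans (𝟙-∧ (adj T x (f fzero)) (isWalk m f)) (*-comm (A x (f fzero)) _)) ⟩
      𝟙 (isWalk m f) * A x (f fzero) * ψ x (f (fromℕ m))
        ≡⟨ *-assoc (𝟙 (isWalk m f)) (A x (f fzero)) _ ⟩
      𝟙 (isWalk m f) * (A x (f fzero) * ψ x (f (fromℕ m)))
        ≡⟨ cong (λ u → 𝟙 (isWalk m f) * (u * ψ x (f (fromℕ m)))) (symmetric x (f fzero)) ⟩
      𝟙 (isWalk m f) * (A (f fzero) x * ψ x (f (fromℕ m))) ∎
      where open ≡-Reasoning

  walks-pow : ∀ m j → walks m (pow A j) ≡ ∑ vertices λ x → pow A (m + j) x x
  walks-pow zero    j = walks-zero (pow A j)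
  walks-pow (suc m) j = trans (walks-suc m (pow A j))
    (trans (walks-pow m (suc j)) (cong (λ u → ∑ vertices λ x → pow A u x x) (+-suc m j)))

  hom-Cycle : ∀ i → hom (Cycle (suc (suc i))) T ≡ Graph.cycles G i
  hom-Cycle i = begin
    hom (Cycle (suc (suc i))) T
      ≡⟨ (∑-cong (allMaps (suc (suc i)) n) λ f → trans (cong 𝟙 (isHom-Cycle (suc i) f)) (𝟙-∧ (isWalk (suc i) f) _)) ⟩
    walks (suc i) (pow A 0)
      ≡⟨ walks-pow (suc i) 0 ⟩
    ∑ vertices (λ x → pow A (suc (i + 0)) x x)
      ≡⟨ cong (λ u → ∑ vertices λ x → pow A (suc u) x x) (+-identityʳ i) ⟩
    ∑ vertices (λ x → pow A (suc i) x x)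
      ≡⟨ ∑∑-cong (λ x y → cong (A x y *_) (pow-symmetric symmetric i y x)) ⟩
    Graph.cycles G i ∎
    where open ≡-Reasoning

  order-toGraph : Graph.order G ≡ n
  order-toGraph = length-tabulate id

-- From counts to densities

CLe-cycles : ∀ i j p s t →
  (∃ λ K → ∀ G → cycles G i ^ p ≤ K * (order G ^ s * cycles G j ^ t)) →
  (2 + i) * p ≡ (2 + j) * t + s → CLe (Cycle (2 + j)) (Cycle (2 + i)) p t
CLe-cycles i j p s t bound exponents T simple _ = begin
  hom (Cycle (2 + i)) T ^ p * n ^ ((2 + j) * t)      ≡⟨ cong (λ u → u ^ p * n ^ ((2 + j) * t)) (hom-Cycle T simple i) ⟩
  cycles G i ^ p * n ^ ((2 + j) * t)                 ≤⟨ *-monoˡ-≤ (n ^ ((2 + j) * t)) (tensorTrick i j p s t bound G) ⟩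
  order G ^ s * cycles G j ^ t * n ^ ((2 + j) * t)   ≡⟨ cong₂ (λ u v → u ^ s * v ^ t * n ^ ((2 + j) * t)) (order-toGraph T simple) (sym (hom-Cycle T simple j)) ⟩
  -- By `exponents`, the factor n^s is exactly what the normalisations of the two densities differ
  -- by.
  n ^ s * b ^ t * n ^ ((2 + j) * t)                  ≡⟨ rearrange (n ^ s) (b ^ t) (n ^ ((2 + j) * t)) ⟩
  b ^ t * (n ^ ((2 + j) * t) * n ^ s)                ≡⟨ cong (b ^ t *_) (^-distribˡ-+-* n ((2 + j) * t) s) ⟨
  b ^ t * n ^ ((2 + j) * t + s)                      ≡⟨ cong (λ u → b ^ t * n ^ u) exponents ⟨
  b ^ t * n ^ ((2 + i) * p)                          ∎
  where
  open ≤-Reasoning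
  n b : ℕ
  n = V T
  b = hom (Cycle (2 + j)) T
  G : Graph
  G = toGraph T simple
  rearrange : ∀ x y z → x * y * z ≡ y * (z * x)
  rearrange = solve-∀

CLe-subst : ∀ {g g′ h h′ p p′ q q′} → g ≡ g′ → h ≡ h′ → p ≡ p′ → q ≡ q′ →
  CLe (Cycle g) (Cycle h) p q → CLe (Cycle g′) (Cycle h′) p′ q′
CLe-subst refl refl refl refl c = c

module _ (l m : ℕ) where
  private
    k ℓ v M : ℕ
    k = suc l + m
    ℓ = suc l
    v = l + suc l
    M = m + m

    vertices-ℓ : ∀ l → 2 + suc (l + l) ≡ 2 * suc l + 1
    vertices-ℓ = solve-∀

    vertices-k : ∀ l m → 2 + (suc (l + l) + (m + m)) ≡ 2 * (suc l + m) + 1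
    vertices-k = solve-∀

  cyclesBound₁ : m ≤ l → CLe (Cycle (2 * k + 1)) (Cycle (2 * ℓ + 1)) (2 * (k + 1)) (2 * ℓ + 1)
  cyclesBound₁ m≤l = CLe-subst (vertices-k l m) (vertices-ℓ l) (numerator l m) (denominator l)
    (CLe-cycles (suc (l + l)) (suc (l + l) + M) (L + suc M) L L (roughBound₁ l m m≤l) (exponents l m))
    where
    L : ℕ
    L = suc l + suc (suc l)
    numerator : ∀ l m → suc l + suc (suc l) + suc (m + m) ≡ 2 * (suc l + m + 1)
    numerator = solve-∀
    denominator : ∀ l → suc l + suc (suc l) ≡ 2 * suc l + 1
    denominator = solve-∀
    exponents : ∀ l m → (2 + suc (l + l)) * (suc l + suc (suc l) + suc (m + m)) ≡
      (2 + (suc (l + l) + (m + m))) * (suc l + suc (suc l)) + (suc l + suc (suc l))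
    exponents = solve-∀

  cyclesBound₂ : ℓ ≤ m → CLe (Cycle (2 * k + 1)) (Cycle (2 * ℓ + 1))
    (2 * k * ((2 * k + 1) ∸ 2 * ℓ) ∸ 1) (2 * ℓ * ((2 * k + 1) ∸ 2 * ℓ) ∸ 1)
  cyclesBound₂ ℓ≤m = CLe-subst (vertices-k l m) (vertices-ℓ l)
    (trans (cong (_∸ 1) (numerator l m)) (cong (λ u → 2 * k * u ∸ 1) (sym difference)))
    (trans (cong (_∸ 1) (denominator l m)) (cong (λ u → 2 * ℓ * u ∸ 1) (sym difference)))
    (CLe-cycles (suc (l + l)) (suc (l + l) + M) ((suc m + suc m) * M + v * suc M) ((suc m + suc m) * M)
      (M + v * suc M) rough (exponents l m))
    where
    rough : ∃ λ K → ∀ G → cycles G (suc (l + l)) ^ ((suc m + suc m) * M + v * suc M) ≤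
      K * (order G ^ ((suc m + suc m) * M) * cycles G (suc (l + l) + M) ^ (M + v * suc M))
    -- Writing m = ℓ + d gives the form in which r = 2m + 2 exceeds 2ℓ + 1.
    rough with d , refl ← m≤n⇒∃[o]m+o≡n ℓ≤m = roughBound₂ l d
    split : ∀ l m → 2 * (suc l + m) + 1 ≡ 2 * suc l + suc (m + m)
    split = solve-∀
    difference : (2 * k + 1) ∸ 2 * ℓ ≡ suc M
    difference = trans (cong (_∸ 2 * ℓ) (split l m)) (m+n∸m≡n (2 * ℓ) (suc M))
    -- Since (2m+2)(2m) = (2m+1)² - 1 and v = 2ℓ - 1, the exponent of E is (2m+1)(2m+2ℓ) - 1, where
    -- 2m + 2ℓ = 2k. Adding 1 on the left avoids truncated subtraction.
    numerator : ∀ l m →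
      suc ((suc m + suc m) * (m + m) + (l + suc l) * suc (m + m)) ≡ 2 * (suc l + m) * suc (m + m)
    numerator = solve-∀
    denominator : ∀ l m → suc (m + m + (l + suc l) * suc (m + m)) ≡ 2 * suc l * suc (m + m)
    denominator = solve-∀
    exponents : ∀ l m →
      (2 + suc (l + l)) * ((suc m + suc m) * (m + m) + (l + suc l) * suc (m + m)) ≡
      (2 + (suc (l + l) + (m + m))) * (m + m + (l + suc l) * suc (m + m)) + (suc m + suc m) * (m + m)
    exponents = solve-∀

theorem4p6 : (k ℓ : ℕ) → 1 ≤ ℓ → ℓ < k →
    (k ≤ 2 * ℓ ∸ 1 →
    CLe (Cycle (2 * k + 1)) (Cycle (2 * ℓ + 1)) (2 * (k + 1)) (2 * ℓ + 1))
    × (2 * ℓ ≤ k →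
    CLe (Cycle (2 * k + 1)) (Cycle (2 * ℓ + 1))
    (2 * k * ((2 * k + 1) ∸ 2 * ℓ) ∸ 1)
    (2 * ℓ * ((2 * k + 1) ∸ 2 * ℓ) ∸ 1))
-- With k = ℓ + m and ℓ = l + 1 the two cases become m ≤ l and ℓ ≤ m.
theorem4p6 k ℓ@(suc l) _ ℓ<k with m , refl ← m≤n⇒∃[o]m+o≡n (<⇒≤ ℓ<k) =
    (λ k≤2ℓ∸1 → cyclesBound₁ l m (+-cancelˡ-≤ ℓ m l (≤-trans k≤2ℓ∸1 (≤-reflexive (2ℓ∸1 l)))))
  , (λ 2ℓ≤k → cyclesBound₂ l m (+-cancelˡ-≤ ℓ ℓ m (≤-trans (≤-reflexive (cong (ℓ +_) (sym (+-identityʳ ℓ)))) 2ℓ≤k)))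
  where
  2ℓ∸1 : ∀ l → l + (suc l + 0) ≡ suc l + l
  2ℓ∸1 = solve-∀
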